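{- Let $k,t$ be integers with $1\le t\le k$, let $s_1,\dots,s_k$ be positive integers, let $G=\mathbb{Z}_{s_1}\times\mathbb{Z}_{s_2}\times\cdots\times\mathbb{Z}_{s_k}$, and let $A$ be a nonempty finite multiset of elements of $G$ (the rows of $A$). Then $A$ is an $\mathrm{OA}(|A|,s_1s_2\cdots s_k,t)$ over $G$ if and only if $$\sum_{\mathbf x\in A}\chi_{\mathbf m}(\mathbf x)=0$$ for all nonzero elements $\mathbf m\in G$ with $|\operatorname{supp}(\mathbf m)|\le t$, where the sum runs over the rows of $A$ counted with multiplicity.
   Context: For a positive integer $s$, $\mathbb{Z}_s=\{0,1,\dots,s-1\}$ is the additive group modulo $s$. For $I=\{i_1,\dots,i_t\}\subseteq\{1,\dots,k\}$ let $G_I=\mathbb{Z}_{s_{i_1}}\times\cdots\times\mathbb{Z}_{s_{i_t}}$ and let $\pi_I:G\to G_I$ be the coordinate projection. A finite multiset $A$ of elements of $G$, of cardinality $|A|$ counted with multiplicity, is an orthogonal array of strength $t$ over $G$, denoted $\mathrm{OA}(|A|,s_1s_2\cdots s_k,t)$ (here $s_1s_2\cdots s_k$ is the list of numbers of levels, not a product), if for every $I\subseteq\{1,\dots,k\}$ with $|I|=t$ there is a positive integer $\lambda_I$ such that $|\{\alpha\in A:\pi_I(\alpha)=\beta\}|=\lambda_I$ for all $\beta\in G_I$ (counted with multiplicity). For $\mathbf m=(m_1,\dots,m_k)\in G$, $\chi_{\mathbf m}:G\to\mathbb{C}^*$ is the character $\chi_{\mathbf m}(\mathbf x)=\prod_{j=1}^k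 e^{2\pi i m_jx_j/s_j}$, and $\operatorname{supp}(\mathbf m)=\{j:m_j\neq0\}$. -}

module Defs where

open import Algebra.Apartness.Bundles using (HeytingField; HeytingCommutativeRing)
open import Algebra.Bundles.Raw using (RawRing)
open import Algebra.Bundles using (CommutativeRing)
import Algebra.Apartness.Properties.HeytingCommutativeRing as HeytingProperties
import Algebra.Definitions.RawSemiring as RawSemiringDefs
import Algebra.Properties.Ring as RingProperties
open import Data.Empty using (⊥-elim)
open import Data.Fin.Base using (Fin; toℕ)
import Data.Fin.Properties as Fin
open import Data.Fin.Subset using (Subset; _∈_; ∣_∣)
open import Data.Fin.Subset.Properties using (_∈?_)
open import Data.List.Base as List using (List; length; filter)
open import Data.Nat.Base as ℕ using (ℕ; zero; suc; NonZero; _!)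
open import Data.Nat.Properties using (_!≢0)
import Data.Nat.Properties as ℕ
open import Data.Product.Base using (_×_; _,_; ∃-syntax; proj₁; proj₂)
open import Data.Sum.Base using (_⊎_; inj₁; inj₂)
open import Data.Vec.Base using (tabulate)
open import Data.Vec.Properties.WithK using ([]=-irrelevant)
open import Level using (_⊔_) renaming (suc to lsuc)
open import Relation.Binary.Core using (Rel)
open import Relation.Binary.PropositionalEquality.Core using (_≡_; subst)
open import Relation.Binary.Structures using (IsStrictPartialOrder)
open import Relation.Nullary using (¬_; Dec; yes; no; does)
open import Relation.Nullary.Decidable using (¬?; map′)

------------------------------------------------------------------------
-- Phrased with an apartness relation (x # y iff x < y or
-- y < x) instead of trichotomy, so that the constructive reals qualify too.

record OrderedField c ℓ₁ ℓ₂ : Set (lsuc (c ⊔ ℓ₁ ⊔ ℓ₂)) where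
  infix 4 _<_ _⟶_
  field
    heytingField : HeytingField c ℓ₁ ℓ₂

  open HeytingField heytingField public
    renaming (refl to ≈-refl; sym to ≈-sym; trans to ≈-trans)
  open HeytingCommutativeRing heytingCommutativeRing public using (commutativeRing)
  open CommutativeRing commutativeRing public using (ring)

  field
    _<_                  : Rel Carrier ℓ₂
    isStrictPartialOrder : IsStrictPartialOrder _≈_ _<_
    #⇒<⊎>                : ∀ {x y} → x # y → x < y ⊎ y < x
    <⇒#                  : ∀ {x y} → x < y → x # y
    +-monoˡ-<            : ∀ {x y} z → x < y → x + z < y + z
    *-pos                : ∀ {x y} → 0# < x → 0# < y → 0# < x * y

  open IsStrictPartialOrder isStrictPartialOrder public using (<-resp-≈; <-respʳ-≈; <-respˡ-≈)
    renaming ( irrefl to <-irrefl; trans to <-trans )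

  private
    open RingProperties ring using (-1*x≈-x; -‿involutive)
    open RawSemiringDefs
      (RawRing.rawSemiring (CommutativeRing.rawRing commutativeRing)) using ()
      renaming (_×_ to _·ℕ_)

  fromℕ : ℕ → Carrier
  fromℕ n = n ·ℕ 1#

  -- |u m - u n| < ε for all m, n ≥ N: the other half of the absolute value
  -- is obtained by exchanging m and n.
  IsCauchy : (ℕ → Carrier) → Set (c ⊔ ℓ₂)
  IsCauchy u = ∀ ε → 0# < ε →
    ∃[ N ] (∀ m n → N ℕ.≤ m → N ℕ.≤ n → u m - u n < ε)

  _⟶_ : (ℕ → Carrier) → Carrier → Set (c ⊔ ℓ₂)
  u ⟶ L = ∀ ε → 0# < ε →
    ∃[ N ] (∀ n → N ℕ.≤ n → (u n - L < ε) × (L - u n < ε))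

  0<1 : 0# < 1#
  0<1 with #⇒<⊎> (HeytingProperties.1#0 heytingCommutativeRing)
  ... | inj₂ 0<1 = 0<1
  ... | inj₁ 1<0 = <-respʳ-≈ [-1]²≈1 (*-pos 0<-1 0<-1)
    where
    0<-1 : 0# < - 1#
    0<-1 = <-respˡ-≈ (-‿inverseʳ 1#)
             (<-respʳ-≈ (+-identityˡ (- 1#)) (+-monoˡ-< (- 1#) 1<0))
    [-1]²≈1 : - 1# * - 1# ≈ 1#
    [-1]²≈1 = ≈-trans (-1*x≈-x (- 1#)) (-‿involutive 1#)

  0<fromℕ : ∀ n → 0# < fromℕ (suc n)
  0<fromℕ zero    = <-respʳ-≈ (≈-sym (+-identityʳ 1#)) 0<1
  0<fromℕ (suc n) = <-trans (0<fromℕ n)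
    (<-respˡ-≈ (+-identityˡ (fromℕ (suc n))) (+-monoˡ-< (fromℕ (suc n)) 0<1))

  1/_ : ∀ n .{{_ : NonZero n}} → Carrier
  1/ suc n = proj₁ (#⇒invertible (#-sym (<⇒# (0<fromℕ n))))

------------------------------------------------------------------------
-- The real numbers: a Cauchy-complete Archimedean ordered field.
-- Classically these axioms determine ℝ up to unique isomorphism.

record RealNumbers c ℓ₁ ℓ₂ : Set (lsuc (c ⊔ ℓ₁ ⊔ ℓ₂)) where
  field
    orderedField : OrderedField c ℓ₁ ℓ₂

  open OrderedField orderedField public

  field
    archimedean : ∀ x → ∃[ n ] (x < fromℕ n)
    complete    : ∀ u → IsCauchy u → ∃[ L ] (u ⟶ L)

------------------------------------------------------------------------

module Complex {c ℓ₁ ℓ₂} (R : RealNumbers c ℓ₁ ℓ₂) where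
  open RealNumbers R renaming (Carrier to ℝ)

  ℂ : Set c
  ℂ = ℝ × ℝ

  Re Im : ℂ → ℝ
  Re = proj₁
  Im = proj₂

  ℂ-rawRing : RawRing c ℓ₁
  ℂ-rawRing = record
    { Carrier = ℂ
    ; _≈_     = λ z w → (Re z ≈ Re w) × (Im z ≈ Im w)
    ; _+_     = λ z w → (Re z + Re w) , (Im z + Im w)
    ; _*_     = λ z w → (Re z * Re w - Im z * Im w) , (Re z * Im w + Im z * Re w)
    ; -_      = λ z → (- Re z) , (- Im z)
    ; 0#      = 0# , 0#
    ; 1#      = 1# , 0#
    }

  open RawRing ℂ-rawRing public using ()
    renaming (_≈_ to _≈ᶜ_; _+_ to _+ᶜ_; _*_ to _*ᶜ_; 0# to 0ᶜ; 1# to 1ᶜ)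
  open RawSemiringDefs (RawRing.rawSemiring ℂ-rawRing) public using ()
    renaming (_^_ to _^ᶜ_; sum to sumᶜ; product to productᶜ)

  sumOver : {X : Set} → List X → (X → ℂ) → ℂ
  sumOver xs f = List.foldr _+ᶜ_ 0ᶜ (List.map f xs)

  fromℝ : ℝ → ℂ
  fromℝ x = x , 0#

  i·_ : ℝ → ℂ
  i· x = 0# , x

  _⟶ᶜ_ : (ℕ → ℂ) → ℂ → Set (c ⊔ ℓ₂)
  u ⟶ᶜ L = ((λ n → Re (u n)) ⟶ Re L) × ((λ n → Im (u n)) ⟶ Im L)

  expPartialSum : ℂ → ℕ → ℂ
  expPartialSum z n = sumᶜ {n} λ j →
    (z ^ᶜ toℕ j) *ᶜ fromℝ (1/_ (toℕ j !) {{toℕ j !≢0}})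

  -- Limits are unique up to ≈ᶜ, so this determines exp.
  IsExp : (ℂ → ℂ) → Set (c ⊔ ℓ₂)
  IsExp exp = ∀ z → expPartialSum z ⟶ᶜ exp z

  -- π is the least positive zero of sin, where sin x = Im (exp (i x)).
  record IsPi (exp : ℂ → ℂ) (π : ℝ) : Set (c ⊔ ℓ₁ ⊔ ℓ₂) where
    sin : ℝ → ℝ
    sin x = Im (exp (i· x))
    field
      π-pos   : 0# < π
      sin-π   : sin π ≈ 0#
      π-least : ∀ x → 0# < x → x < π → ¬ (sin x ≈ 0#)

------------------------------------------------------------------------
-- Orthogonal arrays over G = ℤ_{s₁} × ⋯ × ℤ_{s_k}.  A finite multiset of
-- elements of G is given by a list; its order plays no role below.

module _ {k : ℕ} (s : Fin k → ℕ) where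

  G : Set
  G = (j : Fin k) → Fin (s j)

  IsZero : G → Set
  IsZero m = ∀ j → toℕ (m j) ≡ 0

  supp : G → Subset k
  supp m = tabulate λ j → does (¬? (toℕ (m j) ℕ.≟ 0))

  G[_] : Subset k → Set
  G[ I ] = (j : Fin k) → j ∈ I → Fin (s j)

  proj : (I : Subset k) → G → G[ I ]
  proj I α j _ = α j

  -- Tuples are functions, so they are compared pointwise.
  Equal : (I : Subset k) → Rel G[ I ] _
  Equal I β γ = ∀ j (j∈I : j ∈ I) → β j j∈I ≡ γ j j∈I

  equal? : (I : Subset k) (β γ : G[ I ]) → Dec (Equal I β γ)
  equal? I β γ = Fin.all? at
    where
    at : ∀ j → Dec ((j∈I : j ∈ I) → β j j∈I ≡ γ j j∈I)
    at j with j ∈? I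
    ... | no  j∉I = yes λ j∈I → ⊥-elim (j∉I j∈I)
    ... | yes j∈I = map′
      (λ eq j∈I′ → subst (λ p → β j p ≡ γ j p) ([]=-irrelevant j∈I j∈I′) eq)
      (λ eq → eq j∈I)
      (β j j∈I Fin.≟ γ j j∈I)

  multiplicity : (I : Subset k) → G[ I ] → List G → ℕ
  multiplicity I β A = length (filter (λ α → equal? I (proj I α) β) A)

  IsOA : ℕ → List G → Set
  IsOA t A = (I : Subset k) → ∣ I ∣ ≡ t →
    ∃[ lam ] (0 ℕ.< lam) × ((β : G[ I ]) → multiplicity I β A ≡ lam)

------------------------------------------------------------------------

module Characters {c ℓ₁ ℓ₂} (R : RealNumbers c ℓ₁ ℓ₂) where
  open RealNumbers R using (_*_; fromℕ; 1/_) renaming (Carrier to ℝ)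
  open Complex R

  module _ (exp : ℂ → ℂ) (π : ℝ) {k : ℕ} (s : Fin k → ℕ) where

    -- χ m x = ∏_j exp (2πi m_j x_j / s_j); s j is nonzero because Fin (s j) is
    -- inhabited by m j.
    χ : G s → G s → ℂ
    χ m x = productᶜ λ j → exp (i· (fromℕ 2 * π *
      (fromℕ (toℕ (m j) ℕ.* toℕ (x j)) * 1/_ (s j) {{Fin.nonZeroIndex (m j)}})))

{-# OPTIONS --safe #-}
-- (⇒) Extend supp m to a set I of t coordinates. The projection of A to G_I is uniform, so it is
-- invariant under a shift of some coordinate j with m_j ≠ 0; the shift multiplies ∑ χ_m by
-- ζ^{m_j} ≠ 1, so the sum vanishes.
-- (⇐) The indicator function of a point β of G_I is the product over j in I of
-- (1/s_j) ∑_m ζ_j^{m(x_j - β_j)}. Expanding the product, only the term of the trivial character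
-- contributes to its sum over A, so the multiplicity of β does not depend on β.
--
-- The addition formula for exp holds because E_n(z)E_n(w) - E_n(z + w), with E_n the n-th partial
-- sum, is dominated by E_{2n}(B) - E_n(B) for a real bound B, which tends to 0 because the series
-- converges at B. If cis 2φ = 1 and sin φ ≠ 0 then cos φ = 0, so -sin² φ = 1, which is absurd;
-- hence cis θ ≠ 1 for 0 < θ < 2π. Inequations enter only as negative statements, and equations are
-- proved from them by tightness of apartness, so no decidability of the reals is needed.
module Submission where

open import Defs
import Algebra.Apartness.Properties.HeytingCommutativeRing as HeytingProperties
open import Algebra.Bundles using (CommutativeRing)
open import Algebra.Bundles.Raw using (RawRing)
import Algebra.Properties.CommutativeMonoid.Sum as MonoidSum
import Algebra.Properties.Ring as RingProperties
import Algebra.Properties.Semiring.Exp as SemiringExp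
import Algebra.Properties.Semiring.Mult as SemiringMult
import Algebra.Properties.Semiring.Mult.TCOptimised as SemiringMult′
import Algebra.Properties.Semiring.Sum as SemiringSum
import Algebra.Solver.Ring as RingSolver
open import Algebra.Solver.Ring.AlmostCommutativeRing
  using (fromCommutativeRing; -raw-almostCommutative⟶; _-Raw-AlmostCommutative⟶_)
open import Algebra.Structures using (IsCommutativeRing)
open import Data.Fin.Base as Fin using (Fin; zero; suc; toℕ; inject₁; fromℕ<)
import Data.Fin.Properties as Fin
open import Data.Fin.Relation.Unary.Top using (view; ‵fromℕ; ‵inject₁)
open import Data.Fin.Subset using (Subset; inside; outside; _∈_; _⊆_; ∣_∣; ⊤)
open import Data.Fin.Subset.Properties using (_∈?_; ⊆⊤; ∣⊤∣≡n; s⊆s; out⊆; p⊆q⇒∣p∣≤∣q∣)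
open import Data.List.Base as List using (List; []; _∷_; _++_; filter; length)
import Data.List.Properties as List
open import Data.Maybe.Base using (Maybe; just; nothing)
open import Data.Nat.Base as ℕ using (ℕ; zero; suc; _≤_; z≤n; s≤s; NonZero; _!)
import Data.Nat.Properties as ℕ
open import Data.Nat.Properties using (_!≢0)
open import Data.Product.Base using (_×_; _,_; ∃-syntax; proj₁; proj₂)
open import Data.Sum.Base using (_⊎_; inj₁; inj₂; [_,_]′)
open import Data.Vec.Base using ([]; _∷_)
open import Data.Vec.Properties using (lookup∘tabulate; []=⇒lookup; lookup⇒[]=)
open import Data.Vec.Properties.WithK using ([]=-irrelevant)
open import Function.Base using (_∘_)
open import Function.Bundles using (_⇔_; mk⇔)
open import Level using (_⊔_)
open import Relation.Binary.Definitions using (Tri; tri<; tri≈; tri>)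
open import Relation.Binary.PropositionalEquality as ≡ using (_≡_; _≢_)
import Relation.Binary.Reasoning.Setoid as SetoidReasoning
open import Relation.Nullary using (¬_; Dec; yes; no; contradiction)
open import Relation.Nullary.Decidable using (¬?; dec-true; dec-false)

-- `exp` and `π` are arbitrary data: `exp` is known only as a pointwise limit of partial sums, `π`
-- only as the least positive zero of the sine made from it. That `exp` respects `_≈ᶜ_` and commutes
-- with conjugation must be won, like the addition formula, from uniqueness of limits before roots
-- of unity can be handled. Minimality of `π` yields nonvanishing as a bare negation, never an
-- inverse. So nothing is divided by u - 1: a sum S is shown to vanish from (u - 1)S = 0 and u ≠ 1
-- by `*ᶜ-cancel-≉0`. In the converse λ is not computed as |A| divided by the product of the `s j`
-- with j in I. Two points β and γ are compared mode by mode through the same expansion, and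
-- positivity of λ comes from a row of the array. A single I of size t can be treated on its own
-- there, because expanding an indicator on G_I produces only characters supported in I, whose
-- supports have at most t elements.

-- To cancel x - x the solver needs coefficients with decidable equality: integers,
-- represented as reduced differences of naturals.
module IntegerSolver {c ℓ} (K : CommutativeRing c ℓ) where
  open CommutativeRing K
  open SemiringMult′ semiring using (1+×; ×-homo-+; ×1-homo-*) renaming (_×_ to _·_)
  open RingProperties ring using (-0#≈0#; x[y-z]≈xy-xz; [y-z]x≈yx-zx; ⁻¹-anti-homo-//)
  open SetoidReasoning setoid

  private
    -- Bootstrap: this solver never identifies two coefficients, so it rearranges sums and products
    -- but cannot cancel. It proves the identities on which the cancelling solver rests.
    module S = RingSolver rawRing (fromCommutativeRing K)
      (-raw-almostCommutative⟶ (fromCommutativeRing K)) (λ _ _ → nothing)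

    -- The separate case for a zero subtrahend makes (0 , 0) and (1 , 0) compute to `0#` and `1#`,
    -- so the constants `:0` and `:1` match goals definitionally.
    ⟦_⟧ : ℕ × ℕ → Carrier
    ⟦ a , zero ⟧  = a · 1#
    ⟦ a , suc b ⟧ = a · 1# - suc b · 1#

    ⟦⟧≈ : ∀ a b → ⟦ a , b ⟧ ≈ a · 1# - b · 1#
    ⟦⟧≈ a zero    = sym (trans (+-congˡ -0#≈0#) (+-identityʳ _))
    ⟦⟧≈ a (suc b) = refl

    reduce : ℕ → ℕ → ℕ × ℕ
    reduce (suc a) (suc b) = reduce a b
    reduce a       b       = a , b

    ⟦reduce⟧≈ : ∀ a b → ⟦ reduce a b ⟧ ≈ a · 1# - b · 1#
    ⟦reduce⟧≈ 0       b       = ⟦⟧≈ 0 b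
    ⟦reduce⟧≈ (suc a) 0       = ⟦⟧≈ (suc a) 0
    ⟦reduce⟧≈ (suc a) (suc b) = begin
      ⟦ reduce a b ⟧                    ≈⟨ ⟦reduce⟧≈ a b ⟩
      a · 1# - b · 1#                   ≈⟨ +-identityˡ _ ⟨
      0# + (a · 1# - b · 1#)            ≈⟨ +-congʳ (-‿inverseʳ 1#) ⟨
      (1# - 1#) + (a · 1# - b · 1#)
        ≈⟨ S.solve 3 (λ i a b → (i S.:- i) S.:+ (a S.:- b) S.:= (i S.:+ a) S.:- (i S.:+ b)) refl
             1# (a · 1#) (b · 1#) ⟩
      (1# + a · 1#) - (1# + b · 1#)     ≈⟨ +-cong (1+× a 1#) (-‿cong (1+× b 1#)) ⟨
      suc a · 1# - suc b · 1#           ∎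

    differences : RawRing _ _
    differences = record
      { Carrier = ℕ × ℕ
      ; _≈_     = _≡_
      ; _+_     = λ (a , b) (c , d) → reduce (a ℕ.+ c) (b ℕ.+ d)
      ; _*_     = λ (a , b) (c , d) → reduce (a ℕ.* c ℕ.+ b ℕ.* d) (a ℕ.* d ℕ.+ b ℕ.* c)
      ; -_      = λ (a , b) → b , a
      ; 0#      = 0 , 0
      ; 1#      = 1 , 0
      }

    ×-homo-*+* : ∀ a b c d →
      (a ℕ.* b ℕ.+ c ℕ.* d) · 1# ≈ (a · 1#) * (b · 1#) + (c · 1#) * (d · 1#)
    ×-homo-*+* a b c d = trans (×-homo-+ 1# (a ℕ.* b) (c ℕ.* d))
                               (+-cong (×1-homo-* a b) (×1-homo-* c d))

    -*- : ∀ a b c d → (a * c + b * d) - (a * d + b * c) ≈ (a - b) * (c - d)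
    -*- a b c d = begin
      (a * c + b * d) - (a * d + b * c)
        ≈⟨ S.solve 4 (λ x y z w → (x S.:+ y) S.:- (z S.:+ w) S.:= (x S.:- w) S.:+ (y S.:- z))
             refl (a * c) (b * d) (a * d) (b * c) ⟩
      (a * c - b * c) + (b * d - a * d)  ≈⟨ +-congˡ (⁻¹-anti-homo-// (a * d) (b * d)) ⟨
      (a * c - b * c) - (a * d - b * d)  ≈⟨ +-cong ([y-z]x≈yx-zx c a b) (-‿cong ([y-z]x≈yx-zx d a b)) ⟨
      (a - b) * c - (a - b) * d          ≈⟨ x[y-z]≈xy-xz (a - b) c d ⟨
      (a - b) * (c - d)                  ∎

    homomorphism : differences -Raw-AlmostCommutative⟶ fromCommutativeRing K
    homomorphism = record
      { ⟦_⟧    = ⟦_⟧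
      ; +-homo = λ (a , b) (c , d) → trans (⟦reduce⟧≈ (a ℕ.+ c) (b ℕ.+ d)) (trans
          (+-cong (×-homo-+ 1# a c) (-‿cong (×-homo-+ 1# b d))) (trans
          (S.solve 4 (λ a b c d → (a S.:+ c) S.:- (b S.:+ d) S.:= (a S.:- b) S.:+ (c S.:- d))
            refl (a · 1#) (b · 1#) (c · 1#) (d · 1#))
          (sym (+-cong (⟦⟧≈ a b) (⟦⟧≈ c d)))))
      ; *-homo = λ (a , b) (c , d) → trans
          (⟦reduce⟧≈ (a ℕ.* c ℕ.+ b ℕ.* d) (a ℕ.* d ℕ.+ b ℕ.* c)) (trans
          (+-cong (×-homo-*+* a c b d) (-‿cong (×-homo-*+* a d b c))) (trans
          (-*- (a · 1#) (b · 1#) (c · 1#) (d · 1#))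
          (sym (*-cong (⟦⟧≈ a b) (⟦⟧≈ c d)))))
      ; -‿homo = λ (a , b) → trans (⟦⟧≈ b a) (trans
          (sym (⁻¹-anti-homo-// (a · 1#) (b · 1#))) (-‿cong (sym (⟦⟧≈ a b))))
      ; 0-homo = refl
      ; 1-homo = refl
      }

    -- Comparing cross sums makes the test correct for all pairs, without an invariant that they are
    -- reduced.
    weaklyEqual : ∀ x y → Maybe (⟦ x ⟧ ≈ ⟦ y ⟧)
    weaklyEqual (a , b) (c , d) with a ℕ.+ d ℕ.≟ c ℕ.+ b
    ... | no  _         = nothing
    ... | yes a+d≡c+b = just (begin
      ⟦ a , b ⟧                                  ≈⟨ ⟦⟧≈ a b ⟩
      A - B                                      ≈⟨ +-identityʳ _ ⟨
      (A - B) + 0#                               ≈⟨ +-congˡ (-‿inverseʳ D) ⟨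
      (A - B) + (D - D)
        ≈⟨ S.solve 3 (λ a b d → (a S.:- b) S.:+ (d S.:- d) S.:= (a S.:+ d) S.:- (b S.:+ d)) refl A B D ⟩
      (A + D) - (B + D)                          ≈⟨ +-congʳ A+D≈C+B ⟩
      (C + B) - (B + D)
        ≈⟨ S.solve 3 (λ b c d → (c S.:+ b) S.:- (b S.:+ d) S.:= (c S.:- d) S.:+ (b S.:- b)) refl B C D ⟩
      (C - D) + (B - B)                          ≈⟨ +-congˡ (-‿inverseʳ B) ⟩
      (C - D) + 0#                               ≈⟨ +-identityʳ _ ⟩
      C - D                                      ≈⟨ ⟦⟧≈ c d ⟨
      ⟦ c , d ⟧                                  ∎)
      where
      A = a · 1# ; B = b · 1# ; C = c · 1# ; D = d · 1#
      A+D≈C+B : A + D ≈ C + B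
      A+D≈C+B = trans (sym (×-homo-+ 1# a d))
        (trans (reflexive (≡.cong (_· 1#) a+d≡c+b)) (×-homo-+ 1# c b))

  open RingSolver differences (fromCommutativeRing K) homomorphism weaklyEqual public
    using (solve; con; _:+_; _:*_; _:-_; :-_; _:=_; Polynomial)

  :0 :1 : ∀ {n} → Polynomial n
  :0 = con (0 , 0)
  :1 = con (1 , 0)

-- Cauchy products and exponential series over a commutative ring

module PowerSeries {c ℓ} (K : CommutativeRing c ℓ) where
  open CommutativeRing K
  open IntegerSolver K
  open SemiringSum semiring
  open SemiringExp semiring using (_^_)
  open SemiringMult semiring using () renaming (_×_ to _·_)
  open SetoidReasoning setoid

  private
    ν : ℕ → Carrier
    ν n = n · 1#

  partialSum : (ℕ → Carrier) → ℕ → Carrier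
  partialSum a n = sum {n} (a ∘ toℕ)

  -- The sum of a_i b_j over i + j = n, by recursion on the first factor so that no subtraction n -
  -- i occurs.
  convolution : (a b : ℕ → Carrier) → ℕ → Carrier
  convolution a b zero    = a 0 * b 0
  convolution a b (suc n) = a 0 * b (suc n) + convolution (a ∘ suc) b n

  -- The sum of a_i b_j over i + j < n, row by row; the row i = 0 is split off in each step.
  triangle : (a b : ℕ → Carrier) → ℕ → Carrier
  triangle a b zero    = 0#
  triangle a b (suc n) = a 0 * partialSum b (suc n) + triangle (a ∘ suc) b n

  partialSum-cong : ∀ {a b} → (∀ n → a n ≈ b n) → ∀ n → partialSum a n ≈ partialSum b n
  partialSum-cong a≈b n = sum-cong-≋ {n} (λ j → a≈b (toℕ j))

  triangle≈partialSum : ∀ a b n → triangle a b n ≈ partialSum (convolution a b) n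
  triangle≈partialSum a b zero    = refl
  triangle≈partialSum a b (suc n) = begin
    a 0 * (b 0 + Σb) + triangle (a ∘ suc) b n        ≈⟨ +-congˡ (triangle≈partialSum (a ∘ suc) b n) ⟩
    a 0 * (b 0 + Σb) + Σc
      ≈⟨ solve 4 (λ x y z w → x :* (y :+ z) :+ w := x :* y :+ (x :* z :+ w)) refl (a 0) (b 0) Σb Σc ⟩
    a 0 * b 0 + (a 0 * Σb + Σc)
      ≈⟨ +-congˡ (+-congʳ (*-distribˡ-sum (a 0) (b ∘ suc ∘ toℕ {n}))) ⟩
    a 0 * b 0 + (partialSum (λ j → a 0 * b (suc j)) n + Σc)
      ≈⟨ +-congˡ (∑-distrib-+ (λ j → a 0 * b (suc (toℕ {n} j))) (convolution (a ∘ suc) b ∘ toℕ)) ⟨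
    partialSum (convolution a b) (suc n)             ∎
    where
    Σb = partialSum (b ∘ suc) n
    Σc = partialSum (convolution (a ∘ suc) b) n

  convolution-cong : ∀ {a a′ b b′} → (∀ n → a n ≈ a′ n) → (∀ n → b n ≈ b′ n) →
    ∀ n → convolution a b n ≈ convolution a′ b′ n
  convolution-cong a≈ b≈ zero    = *-cong (a≈ 0) (b≈ 0)
  convolution-cong a≈ b≈ (suc n) =
    +-cong (*-cong (a≈ 0) (b≈ (suc n))) (convolution-cong (a≈ ∘ suc) b≈ n)

  convolution-sucʳ : ∀ a b n →
    convolution a b (suc n) ≈ convolution a (b ∘ suc) n + a (suc n) * b 0
  convolution-sucʳ a b zero    = refl
  convolution-sucʳ a b (suc n) =
    trans (+-congˡ (convolution-sucʳ (a ∘ suc) b n)) (sym (+-assoc _ _ _))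

  convolution-*ˡ : ∀ x a b n → convolution (λ i → x * a i) b n ≈ x * convolution a b n
  convolution-*ˡ x a b zero    = *-assoc x (a 0) (b 0)
  convolution-*ˡ x a b (suc n) = trans
    (+-cong (*-assoc x (a 0) (b (suc n))) (convolution-*ˡ x (a ∘ suc) b n)) (sym (distribˡ x _ _))

  convolution-*ʳ : ∀ x a b n → convolution a (λ i → x * b i) n ≈ x * convolution a b n
  convolution-*ʳ x a b zero    =
    solve 3 (λ x a b → a :* (x :* b) := x :* (a :* b)) refl x (a 0) (b 0)
  convolution-*ʳ x a b (suc n) = trans (+-congˡ (convolution-*ʳ x (a ∘ suc) b n))
    (solve 4 (λ x a b c → a :* (x :* b) :+ x :* c := x :* (a :* b :+ c)) refl
      x (a 0) (b (suc n)) (convolution (a ∘ suc) b n))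

  -- Multiplying the n-th coefficient by n is a derivation; the offset x makes
  -- the induction go through.
  convolution-derivation : ∀ x a b n → (x + ν n) * convolution a b n ≈
    convolution (λ i → (x + ν i) * a i) b n + convolution a (λ j → ν j * b j) n
  convolution-derivation x a b zero    =
    solve 3 (λ x a b → (x :+ :0) :* (a :* b) := ((x :+ :0) :* a) :* b :+ a :* (:0 :* b))
      refl x (a 0) (b 0)
  convolution-derivation x a b (suc n) = begin
    (x + (1# + ν n)) * (a 0 * b (suc n) + C)
      ≈⟨ solve 5 (λ x n a b c → (x :+ (:1 :+ n)) :* (a :* b :+ c)
           := (x :+ (:1 :+ n)) :* (a :* b) :+ ((x :+ :1) :+ n) :* c) refl x (ν n) (a 0) (b (suc n)) C ⟩
    (x + (1# + ν n)) * (a 0 * b (suc n)) + ((x + 1#) + ν n) * C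
      ≈⟨ +-congˡ (trans (convolution-derivation (x + 1#) (a ∘ suc) b n)
           (+-congʳ (convolution-cong (λ i → *-congʳ (+-assoc x 1# (ν i))) (λ _ → refl) n))) ⟩
    (x + (1# + ν n)) * (a 0 * b (suc n)) + (P + Q)
      ≈⟨ solve 6 (λ x n a b p q → (x :+ (:1 :+ n)) :* (a :* b) :+ (p :+ q)
           := (((x :+ :0) :* a) :* b :+ p) :+ (a :* ((:1 :+ n) :* b) :+ q))
           refl x (ν n) (a 0) (b (suc n)) P Q ⟩
    (((x + 0#) * a 0) * b (suc n) + P) + (a 0 * ((1# + ν n) * b (suc n)) + Q) ∎
    where
    C = convolution (a ∘ suc) b n
    P = convolution (λ i → (x + (1# + ν i)) * a (suc i)) b n
    Q = convolution (a ∘ suc) (λ j → ν j * b j) n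

  -0#-identityʳ : ∀ x → x - 0# ≈ x
  -0#-identityʳ = solve 1 (λ x → x :- :0 := x) refl

  partialSum-suc-difference : ∀ a n p →
    partialSum a (suc n) - partialSum a (suc p) ≈ partialSum (a ∘ suc) n - partialSum (a ∘ suc) p
  partialSum-suc-difference a n p =
    solve 3 (λ x y z → (x :+ y) :- (x :+ z) := y :- z) refl
      (a 0) (partialSum (a ∘ suc) n) (partialSum (a ∘ suc) p)

  -- Splits the row i = 0 off the index set "rectangle minus triangle". The complex series and its
  -- real majorant both follow this recursion, which allows a termwise comparison.
  rectangle-triangle-suc : ∀ a b m n p →
    partialSum a (suc m) * partialSum b n - triangle a b (suc p) ≈
    a 0 * (partialSum b n - partialSum b (suc p)) +
    (partialSum (a ∘ suc) m * partialSum b n - triangle (a ∘ suc) b p)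
  rectangle-triangle-suc a b m n p =
    solve 5 (λ x A B B′ T → (x :+ A) :* B :- (x :* B′ :+ T) := x :* (B :- B′) :+ (A :* B :- T)) refl
      (a 0) (partialSum (a ∘ suc) m) (partialSum b n) (partialSum b (suc p)) (triangle (a ∘ suc) b p)

  geometric : ∀ v n → (v - 1#) * partialSum (v ^_) n ≈ v ^ n - 1#
  geometric v zero    = solve 1 (λ v → (v :- :1) :* :0 := :1 :- :1) refl v
  geometric v (suc n) = begin
    (v - 1#) * (1# + partialSum (λ j → v * v ^ j) n)
      ≈⟨ *-congˡ (+-congˡ (*-distribˡ-sum v (λ j → v ^ toℕ {n} j))) ⟨
    (v - 1#) * (1# + v * P)
      ≈⟨ solve 2 (λ v p → (v :- :1) :* (:1 :+ v :* p) := (v :- :1) :+ v :* ((v :- :1) :* p)) refl v P ⟩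
    (v - 1#) + v * ((v - 1#) * P)  ≈⟨ +-congˡ (*-congˡ (geometric v n)) ⟩
    (v - 1#) + v * (v ^ n - 1#)
      ≈⟨ solve 2 (λ v w → (v :- :1) :+ v :* (w :- :1) := v :* w :- :1) refl v (v ^ n) ⟩
    v * v ^ n - 1#                 ∎
    where P = partialSum (v ^_) n

  -- Abstract in the reciprocals so that one argument serves both ℝ and ℂ.
  module Exponential (1/[1+_] 1/_! : ℕ → Carrier)
    (inverse : ∀ n → ν (suc n) * 1/[1+ n ] ≈ 1#)
    (1/0!≈1 : 1/ 0 ! ≈ 1#)
    (1/-suc-! : ∀ n → ν (suc n) * 1/ suc n ! ≈ 1/ n !)
    where

    term : Carrier → ℕ → Carrier
    term z n = (z ^ n) * 1/ n !

    private
      term-suc : ∀ z n → ν (suc n) * term z (suc n) ≈ z * term z n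
      term-suc z n = trans
        (solve 4 (λ n z p f → n :* ((z :* p) :* f) := z :* (p :* (n :* f))) refl
          (ν (suc n)) z (z ^ n) (1/ suc n !))
        (*-congˡ (*-congˡ (1/-suc-! n)))

      cancel : ∀ n {x y} → ν (suc n) * x ≈ ν (suc n) * y → x ≈ y
      cancel n {x} {y} eq = begin
        x                                ≈⟨ *-identityˡ x ⟨
        1# * x                           ≈⟨ *-congʳ (inverse n) ⟨
        (ν (suc n) * 1/[1+ n ]) * x      ≈⟨ swap x ⟩
        1/[1+ n ] * (ν (suc n) * x)      ≈⟨ *-congˡ eq ⟩
        1/[1+ n ] * (ν (suc n) * y)      ≈⟨ swap y ⟨
        (ν (suc n) * 1/[1+ n ]) * y      ≈⟨ *-congʳ (inverse n) ⟩
        1# * y                           ≈⟨ *-identityˡ y ⟩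
        y                                ∎
        where
        swap : ∀ x → (ν (suc n) * 1/[1+ n ]) * x ≈ 1/[1+ n ] * (ν (suc n) * x)
        swap = solve 3 (λ m i x → (m :* i) :* x := i :* (m :* x)) refl (ν (suc n)) 1/[1+ n ]

    -- The binomial theorem without binomial coefficients: by the derivation rule the Cauchy product
    -- c satisfies (n+1) c_(n+1) = (z + w) c_n, the recurrence of the exponential terms of z + w,
    -- and n + 1 can be cancelled.
    convolution-term : ∀ z w n → convolution (term z) (term w) n ≈ term (z + w) n
    convolution-term z w zero    = begin
      (1# * 1/ 0 !) * (1# * 1/ 0 !)  ≈⟨ *-congʳ (trans (*-identityˡ _) 1/0!≈1) ⟩
      1# * (1# * 1/ 0 !)             ≈⟨ *-identityˡ _ ⟩
      1# * 1/ 0 !                    ∎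
    convolution-term z w (suc n) = cancel n (begin
      ν (suc n) * convolution a b (suc n)         ≈⟨ *-congʳ (+-identityˡ _) ⟨
      (0# + ν (suc n)) * convolution a b (suc n)  ≈⟨ convolution-derivation 0# a b (suc n) ⟩
      convolution (λ i → (0# + ν i) * a i) b (suc n) + convolution a (λ j → ν j * b j) (suc n)
        ≈⟨ +-cong left right ⟩
      z * C + w * C                               ≈⟨ distribʳ C z w ⟨
      (z + w) * C                                 ≈⟨ *-congˡ (convolution-term z w n) ⟩
      (z + w) * term (z + w) n                    ≈⟨ term-suc (z + w) n ⟨
      ν (suc n) * term (z + w) (suc n)            ∎)
      where
      a = term z
      b = term w
      C = convolution a b n
      left : convolution (λ i → (0# + ν i) * a i) b (suc n) ≈ z * C
      left = begin
        ((0# + 0#) * a 0) * b (suc n) + convolution (λ i → (0# + ν (suc i)) * a (suc i)) b n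
          ≈⟨ +-cong (solve 2 (λ x y → ((:0 :+ :0) :* x) :* y := :0) refl (a 0) (b (suc n)))
               (convolution-cong (λ i → trans (*-congʳ (+-identityˡ _)) (term-suc z i)) (λ _ → refl) n) ⟩
        0# + convolution (λ i → z * a i) b n   ≈⟨ +-identityˡ _ ⟩
        convolution (λ i → z * a i) b n        ≈⟨ convolution-*ˡ z a b n ⟩
        z * C                                  ∎
      right : convolution a (λ j → ν j * b j) (suc n) ≈ w * C
      right = begin
        convolution a (λ j → ν j * b j) (suc n)  ≈⟨ convolution-sucʳ a (λ j → ν j * b j) n ⟩
        convolution a (λ j → ν (suc j) * b (suc j)) n + a (suc n) * (0# * b 0)
          ≈⟨ +-cong (convolution-cong (λ _ → refl) (term-suc w) n)
               (solve 2 (λ x y → x :* (:0 :* y) := :0) refl (a (suc n)) (b 0)) ⟩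
        convolution a (λ j → w * b j) n + 0#     ≈⟨ +-identityʳ _ ⟩
        convolution a (λ j → w * b j) n          ≈⟨ convolution-*ʳ w a b n ⟩
        w * C                                    ∎

    triangle-term : ∀ z w n → triangle (term z) (term w) n ≈ partialSum (term (z + w)) n
    triangle-term z w n = trans (triangle≈partialSum (term z) (term w) n)
                                (partialSum-cong (convolution-term z w) n)

-- Order, weak inequalities and null sequences in an ordered field

module OrderedFieldProperties {c ℓ₁ ℓ₂} (F : OrderedField c ℓ₁ ℓ₂) where
  open OrderedField F
  open HeytingProperties heytingCommutativeRing using (x-0≈x; invertibleʳ⇒#; #-congʳ)
  open CommutativeRing commutativeRing using (semiring)
  open SemiringMult semiring using (×-homo-+; ×1-homo-*)
  open IntegerSolver commutativeRing
  open SetoidReasoning setoid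

  <⇒0<- : ∀ {x y} → x < y → 0# < y - x
  <⇒0<- {x} x<y = <-respˡ-≈ (-‿inverseʳ x) (+-monoˡ-< (- x) x<y)

  0<-⇒< : ∀ {x y} → 0# < y - x → x < y
  0<-⇒< {x} {y} 0<y-x = <-respʳ-≈ (solve 2 (λ x y → (y :- x) :+ x := y) ≈-refl x y)
    (<-respˡ-≈ (+-identityˡ x) (+-monoˡ-< x 0<y-x))

  <0⇒0<- : ∀ {x} → x < 0# → 0# < - x
  <0⇒0<- {x} x<0 = <-respʳ-≈ (+-identityˡ (- x)) (<⇒0<- x<0)

  <-asym : ∀ {x y} → x < y → ¬ (y < x)
  <-asym x<y y<x = <-irrefl ≈-refl (<-trans x<y y<x)

  -- Takes the place of trichotomy: `z` is apart from one of the endpoints, and on whichever side of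
  -- it `z` lies, one alternative follows.
  <-cotrans : ∀ {x y} → x < y → ∀ z → x < z ⊎ z < y
  <-cotrans x<y z with #-cotrans (<⇒# x<y) z
  ... | inj₁ x#z with #⇒<⊎> x#z
  ...   | inj₁ x<z = inj₁ x<z
  ...   | inj₂ z<x = inj₂ (<-trans z<x x<y)
  <-cotrans x<y z | inj₂ z#y with #⇒<⊎> z#y
  ...   | inj₁ z<y = inj₂ z<y
  ...   | inj₂ y<z = inj₁ (<-trans x<y y<z)

  +-pos : ∀ {x y} → 0# < x → 0# < y → 0# < x + y
  +-pos {x} {y} 0<x 0<y = <-trans 0<y (<-respˡ-≈ (+-identityˡ y) (+-monoˡ-< y 0<x))

  ¬#⇒≈ : ∀ {x y} → ¬ (x # y) → x ≈ y
  ¬#⇒≈ {x} {y} = proj₁ (tight x y)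

  *#0⇒#0 : ∀ {x y} → (x * y) # 0# → x # 0#
  *#0⇒#0 {x} {y} xy#0 with #⇒invertible xy#0
  ... | z , _ , [xy-0]z≈1 = invertibleʳ⇒# (y * z , (begin
    (x - 0#) * (y * z)  ≈⟨ solve 3 (λ x y z → (x :- :0) :* (y :* z) := (x :* y :- :0) :* z) ≈-refl x y z ⟩
    (x * y - 0#) * z    ≈⟨ [xy-0]z≈1 ⟩
    1#                  ∎))

  *≈0∧#0⇒≈0 : ∀ {x y} → x * y ≈ 0# → x # 0# → y ≈ 0#
  *≈0∧#0⇒≈0 {x} {y} xy≈0 x#0 with #⇒invertible x#0
  ... | z , z[x-0]≈1 , _ = begin
    y                  ≈⟨ *-identityˡ y ⟨
    1# * y             ≈⟨ *-congʳ z[x-0]≈1 ⟨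
    (z * (x - 0#)) * y ≈⟨ solve 3 (λ x y z → (z :* (x :- :0)) :* y := z :* (x :* y)) ≈-refl x y z ⟩
    z * (x * y)        ≈⟨ *-congˡ xy≈0 ⟩
    z * 0#             ≈⟨ zeroʳ z ⟩
    0#                 ∎

  *-neg-neg : ∀ {x y} → x < 0# → y < 0# → 0# < x * y
  *-neg-neg {x} {y} x<0 y<0 = <-respʳ-≈ (solve 2 (λ x y → (:- x) :* (:- y) := x :* y) ≈-refl x y)
    (*-pos (<0⇒0<- x<0) (<0⇒0<- y<0))

  *-cancelˡ-pos : ∀ {x y} → 0# < x → 0# < x * y → 0# < y
  *-cancelˡ-pos {x} {y} 0<x 0<xy
    = [ (λ y<0 → contradiction (+-pos 0<xy (*-pos 0<x (<0⇒0<- y<0))) (<-irrefl 0≈xy+x[-y]))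
      , (λ 0<y → 0<y)
      ]′ (#⇒<⊎> (*#0⇒#0 (#-congʳ (*-comm x y) (#-sym (<⇒# 0<xy)))))
    where
    0≈xy+x[-y] : 0# ≈ x * y + x * (- y)
    0≈xy+x[-y] = solve 2 (λ x y → :0 := x :* y :+ x :* (:- y)) ≈-refl x y

  -- A negated strict inequality, so sums and products of such bounds are handled by contradiction
  -- and no sign has to be decided.
  0≤_ : Carrier → Set ℓ₂
  0≤ x = ¬ (x < 0#)

  0≤-resp-≈ : ∀ {x y} → x ≈ y → 0≤ x → 0≤ y
  0≤-resp-≈ x≈y 0≤x y<0 = 0≤x (<-respˡ-≈ (≈-sym x≈y) y<0)

  <⇒0≤ : ∀ {x} → 0# < x → 0≤ x
  <⇒0≤ = <-asym

  0≤0 : 0≤ 0#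
  0≤0 = <-irrefl ≈-refl

  0≤-+ : ∀ {x y} → 0≤ x → 0≤ y → 0≤ (x + y)
  0≤-+ {x} {y} 0≤x 0≤y x+y<0 with <-cotrans x+y<0 x
  ... | inj₂ x<0   = 0≤x x<0
  ... | inj₁ x+y<x = 0≤y (0<-⇒< (<-respʳ-≈
    (solve 2 (λ x y → x :- (x :+ y) := :0 :- y) ≈-refl x y) (<⇒0<- x+y<x)))

  -- A negative product makes `x` apart from 0, hence positive; cancelling it would make `y`
  -- negative.
  0≤-* : ∀ {x y} → 0≤ x → 0≤ y → 0≤ (x * y)
  0≤-* {x} {y} 0≤x 0≤y xy<0 = [ 0≤x , (λ 0<x → 0≤y (0<-⇒< (<-respʳ-≈ (≈-sym (+-identityˡ (- y)))
    (*-cancelˡ-pos 0<x (<-respʳ-≈ (solve 2 (λ x y → :- (x :* y) := x :* (:- y)) ≈-refl x y)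
      (<0⇒0<- xy<0)))))) ]′ (#⇒<⊎> (*#0⇒#0 (<⇒# xy<0)))

  0≤-halve : ∀ {x} → 0≤ (x + x) → 0≤ x
  0≤-halve {x} 0≤2x x<0 = 0≤2x (0<-⇒< (<-respʳ-≈
    (solve 1 (λ x → (:- x) :+ (:- x) := :0 :- (x :+ x)) ≈-refl x)
    (+-pos (<0⇒0<- x<0) (<0⇒0<- x<0))))

  0<-halve : ∀ {x} → 0# < x + x → 0# < x
  0<-halve {x} 0<2x with <-cotrans 0<2x x
  ... | inj₁ 0<x  = 0<x
  ... | inj₂ x<2x = <-respʳ-≈ (solve 1 (λ x → (x :+ x) :- x := x) ≈-refl x) (<⇒0<- x<2x)

  #0⇒0<square : ∀ {x} → x # 0# → 0# < x * x
  #0⇒0<square x#0 = [ (λ x<0 → *-neg-neg x<0 x<0) , (λ 0<x → *-pos 0<x 0<x) ]′ (#⇒<⊎> x#0)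

  0≤-square : ∀ x → 0≤ (x * x)
  0≤-square x x²<0 = <-asym x²<0 (#0⇒0<square (*#0⇒#0 (<⇒# x²<0)))

  0≤-<-trans : ∀ {x y z} → 0≤ (y - x) → y < z → x < z
  0≤-<-trans {x} {y} {z} x≤y y<z with <-cotrans y<z x
  ... | inj₂ x<z = x<z
  ... | inj₁ y<x = contradiction (0<-⇒< (<-respʳ-≈
    (solve 2 (λ x y → x :- y := :0 :- (y :- x)) ≈-refl x y) (<⇒0<- y<x))) x≤y

  +-mono-< : ∀ {x y z w} → x < y → z < w → x + z < y + w
  +-mono-< {x} {y} {z} {w} x<y z<w = 0<-⇒< (<-respʳ-≈
    (solve 4 (λ x y z w → (y :- x) :+ (w :- z) := (y :+ w) :- (x :+ z)) ≈-refl x y z w)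
    (+-pos (<⇒0<- x<y) (<⇒0<- z<w)))

  fromℕ-+ : ∀ m n → fromℕ (m ℕ.+ n) ≈ fromℕ m + fromℕ n
  fromℕ-+ = ×-homo-+ 1#

  fromℕ-* : ∀ m n → fromℕ (m ℕ.* n) ≈ fromℕ m * fromℕ n
  fromℕ-* = ×1-homo-*

  fromℕ-mono-< : ∀ {m n} → m ℕ.< n → fromℕ m < fromℕ n
  fromℕ-mono-< {zero}  {suc n} _         = 0<fromℕ n
  fromℕ-mono-< {suc m} {suc n} (s≤s m<n) =
    <-respʳ-≈ (+-comm _ _) (<-respˡ-≈ (+-comm _ _) (+-monoˡ-< 1# (fromℕ-mono-< m<n)))

  fromℕ-injective : ∀ {m n} → fromℕ m ≈ fromℕ n → m ≡ n
  fromℕ-injective {m} {n} eq with ℕ.<-cmp m n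
  ... | tri< m<n _ _ = contradiction (fromℕ-mono-< m<n) (<-irrefl eq)
  ... | tri≈ _ m≡n _ = m≡n
  ... | tri> _ _ n<m = contradiction (fromℕ-mono-< n<m) (<-irrefl (≈-sym eq))

  *-inverse-fromℕ : ∀ n .{{_ : NonZero n}} → fromℕ n * 1/ n ≈ 1#
  *-inverse-fromℕ (suc n) = begin
    N * 1/ suc n         ≈⟨ *-congʳ (x-0≈x N) ⟨
    (N - 0#) * 1/ suc n  ≈⟨ proj₂ (proj₂ (#⇒invertible (#-sym (<⇒# (0<fromℕ n))))) ⟩
    1#                   ∎
    where N = fromℕ (suc n)

  0<1/ : ∀ n .{{_ : NonZero n}} → 0# < 1/ n
  0<1/ (suc n) = *-cancelˡ-pos (0<fromℕ n) (<-respʳ-≈ (≈-sym (*-inverse-fromℕ (suc n))) 0<1)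

  1/-unique : ∀ n .{{_ : NonZero n}} {x} → fromℕ n * x ≈ 1# → x ≈ 1/ n
  1/-unique n {x} nx≈1 = begin
    x                     ≈⟨ *-identityˡ x ⟨
    1# * x                ≈⟨ *-congʳ (*-inverse-fromℕ n) ⟨
    (fromℕ n * 1/ n) * x  ≈⟨ solve 3 (λ n i x → (n :* i) :* x := i :* (n :* x)) ≈-refl (fromℕ n) (1/ n) x ⟩
    1/ n * (fromℕ n * x)  ≈⟨ *-congˡ nx≈1 ⟩
    1/ n * 1#             ≈⟨ *-identityʳ _ ⟩
    1/ n                  ∎

  *-1/-* : ∀ m n .{{_ : NonZero n}} .{{_ : NonZero (m ℕ.* n)}} → fromℕ m * 1/ (m ℕ.* n) ≈ 1/ n
  *-1/-* m n = 1/-unique n (begin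
    fromℕ n * (fromℕ m * 1/ (m ℕ.* n))
      ≈⟨ solve 3 (λ m n i → n :* (m :* i) := (m :* n) :* i) ≈-refl (fromℕ m) (fromℕ n) (1/ (m ℕ.* n)) ⟩
    (fromℕ m * fromℕ n) * 1/ (m ℕ.* n)  ≈⟨ *-congʳ (fromℕ-* m n) ⟨
    fromℕ (m ℕ.* n) * 1/ (m ℕ.* n)      ≈⟨ *-inverse-fromℕ (m ℕ.* n) ⟩
    1#                                  ∎)

  _/2 : Carrier → Carrier
  x /2 = 1/ 2 * x

  /2+/2 : ∀ x → x /2 + x /2 ≈ x
  /2+/2 x = begin
    1/ 2 * x + 1/ 2 * x
      ≈⟨ solve 2 (λ h x → h :* x :+ h :* x := ((:1 :+ (:1 :+ :0)) :* h) :* x) ≈-refl (1/ 2) x ⟩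
    (fromℕ 2 * 1/ 2) * x ≈⟨ *-congʳ (*-inverse-fromℕ 2) ⟩
    1# * x               ≈⟨ *-identityˡ x ⟩
    x                    ∎

  0</2 : ∀ {x} → 0# < x → 0# < x /2
  0</2 = *-pos (0<1/ 2)

  Eventually : ∀ {p} → (ℕ → Set p) → Set p
  Eventually P = ∃[ N ] (∀ n → N ℕ.≤ n → P n)

  -- Two one-sided bounds in place of an absolute value, which would call for a case distinction on
  -- the sign.
  record ∣_∣<_ (x y : Carrier) : Set ℓ₂ where
    constructor _∧_
    field
      upper : x < y
      lower : - x < y
  open ∣_∣<_ public

  record IsNull (u : ℕ → Carrier) : Set (c ⊔ ℓ₂) where
    constructor null
    field eventually-< : ∀ ε → 0# < ε → Eventually λ n → ∣ u n ∣< ε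
  open IsNull public

  Eventually-∧ : ∀ {p q r} {P : ℕ → Set p} {Q : ℕ → Set q} {R : ℕ → Set r} →
    (∀ n → P n → Q n → R n) → Eventually P → Eventually Q → Eventually R
  Eventually-∧ f (M , p) (N , q) = M ℕ.⊔ N , λ n M⊔N≤n →
    f n (p n (ℕ.≤-trans (ℕ.m≤m⊔n M N) M⊔N≤n)) (q n (ℕ.≤-trans (ℕ.m≤n⊔m M N) M⊔N≤n))

  ∣∣<-resp-≈ : ∀ {x y z} → x ≈ y → ∣ x ∣< z → ∣ y ∣< z
  ∣∣<-resp-≈ x≈y (p ∧ q) = <-respˡ-≈ x≈y p ∧ <-respˡ-≈ (-‿cong x≈y) q

  ∣∣<-+ : ∀ {x y a b} → ∣ x ∣< a → ∣ y ∣< b → ∣ x + y ∣< (a + b)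
  ∣∣<-+ {x} {y} (p ∧ q) (r ∧ s) = +-mono-< p r ∧
    <-respˡ-≈ (solve 2 (λ x y → (:- x) :+ (:- y) := :- (x :+ y)) ≈-refl x y) (+-mono-< q s)

  -- 2(ab ∓ xy) = (a - x)(b ± y) + (a + x)(b ∓ y).
  ∣∣<-* : ∀ {x y a b} → ∣ x ∣< a → ∣ y ∣< b → ∣ x * y ∣< (a * b)
  ∣∣<-* {x} {y} {a} {b} (x<a ∧ -x<a) (y<b ∧ -y<b) =
    0<-⇒< (0<-halve (<-respʳ-≈
      (solve 4 (λ x y a b → (a :- x) :* (b :- (:- y)) :+ (a :- (:- x)) :* (b :- y)
        := (a :* b :- x :* y) :+ (a :* b :- x :* y)) ≈-refl x y a b)
      (+-pos (*-pos (<⇒0<- x<a) (<⇒0<- -y<b)) (*-pos (<⇒0<- -x<a) (<⇒0<- y<b))))) ∧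
    0<-⇒< (0<-halve (<-respʳ-≈
      (solve 4 (λ x y a b → (a :- x) :* (b :- y) :+ (a :- (:- x)) :* (b :- (:- y))
        := (a :* b :- (:- (x :* y))) :+ (a :* b :- (:- (x :* y)))) ≈-refl x y a b)
      (+-pos (*-pos (<⇒0<- x<a) (<⇒0<- y<b)) (*-pos (<⇒0<- -x<a) (<⇒0<- -y<b)))))

  IsNull-resp-≈ : ∀ {u v} → (∀ n → u n ≈ v n) → IsNull u → IsNull v
  IsNull-resp-≈ u≈v (null u→0) = null λ ε 0<ε → let (N , p) = u→0 ε 0<ε in
    N , λ n N≤n → ∣∣<-resp-≈ (u≈v n) (p n N≤n)

  IsNull-+ : ∀ {u v} → IsNull u → IsNull v → IsNull (λ n → u n + v n)
  IsNull-+ {u} {v} (null u→0) (null v→0) = null λ ε 0<ε → Eventually-∧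
    (λ n p q → let (r ∧ s) = ∣∣<-+ {u n} {v n} p q in
      <-respʳ-≈ (/2+/2 ε) r ∧ <-respʳ-≈ (/2+/2 ε) s)
    (u→0 (ε /2) (0</2 0<ε)) (v→0 (ε /2) (0</2 0<ε))

  IsNull-neg : ∀ {u} → IsNull u → IsNull (λ n → - u n)
  IsNull-neg {u} (null u→0) = null λ ε 0<ε → let (N , p) = u→0 ε 0<ε in
    N , λ n N≤n → let (r ∧ s) = p n N≤n in
      s ∧ <-respˡ-≈ (solve 1 (λ x → x := :- (:- x)) ≈-refl (u n)) r

  IsNull-bounded-* : ∀ {u v : ℕ → Carrier} m → Eventually (λ n → ∣ u n ∣< fromℕ (suc m)) →
    IsNull v → IsNull (λ n → u n * v n)
  IsNull-bounded-* {u} {v} m bounded (null v→0) = null λ ε 0<ε → Eventually-∧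
    (λ n p q → let (r ∧ s) = ∣∣<-* {u n} {v n} p q in <-respʳ-≈ (eq ε) r ∧ <-respʳ-≈ (eq ε) s)
    bounded (v→0 (1/ suc m * ε) (*-pos (0<1/ (suc m)) 0<ε))
    where
    eq : ∀ ε → fromℕ (suc m) * (1/ suc m * ε) ≈ ε
    eq ε = ≈-trans (≈-sym (*-assoc _ _ _)) (≈-trans (*-congʳ (*-inverse-fromℕ (suc m))) (*-identityˡ ε))

  -- If the constant were apart from 0, its own absolute value as tolerance would make a number less
  -- than itself; tightness then gives equality.
  IsNull-const : ∀ {x} → IsNull (λ _ → x) → x ≈ 0#
  IsNull-const {x} (null x→0) = ¬#⇒≈ λ x#0 → notApart (#⇒<⊎> x#0)
    where
    notApart : ¬ (x < 0# ⊎ 0# < x)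
    notApart (inj₁ x<0) = let (N , p) = x→0 (- x) (<0⇒0<- x<0) in
      <-irrefl ≈-refl (lower (p N ℕ.≤-refl))
    notApart (inj₂ 0<x) = let (N , p) = x→0 x 0<x in
      <-irrefl ≈-refl (upper (p N ℕ.≤-refl))

  ⟶⇒IsNull : ∀ {u L} → u ⟶ L → IsNull (λ n → u n - L)
  ⟶⇒IsNull {u} {L} u⟶L = null λ ε 0<ε → let (N , p) = u⟶L ε 0<ε in
    N , λ n N≤n → proj₁ (p n N≤n) ∧
    <-respˡ-≈ (solve 2 (λ x y → y :- x := :- (x :- y)) ≈-refl (u n) L) (proj₂ (p n N≤n))

  IsNull-unique : ∀ {u : ℕ → Carrier} {L K} → IsNull (λ n → u n - L) → IsNull (λ n → u n - K) → L ≈ K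
  IsNull-unique {u} {L} {K} u→L u→K = begin
    L             ≈⟨ solve 2 (λ x y → x := (x :- y) :+ y) ≈-refl L K ⟩
    (L - K) + K   ≈⟨ +-congʳ (IsNull-const (IsNull-resp-≈
                       (λ n → solve 3 (λ x y z → (x :- y) :+ (:- (x :- z)) := z :- y) ≈-refl (u n) K L)
                       (IsNull-+ u→K (IsNull-neg u→L)))) ⟩
    0# + K        ≈⟨ +-identityˡ K ⟩
    K             ∎

-- Consequences of the Archimedean property

module RealProperties {c ℓ₁ ℓ₂} (R : RealNumbers c ℓ₁ ℓ₂) where
  open RealNumbers R
  open OrderedFieldProperties orderedField public
  open IntegerSolver commutativeRing

  bound : ∀ x → ∃[ m ] (∣ x ∣< fromℕ (suc m))
  bound x with archimedean x | archimedean (- x)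
  ... | m , x<m | n , -x<n = m ℕ.+ n ,
    <-trans x<m (fromℕ-mono-< (s≤s (ℕ.m≤m+n m n))) ∧
    <-trans -x<n (fromℕ-mono-< (s≤s (ℕ.m≤n+m n m)))

  -- uv - LK = (u - L)(v - K) + L(v - K) + K(u - L).
  IsNull-* : ∀ {u v : ℕ → Carrier} {L K} → IsNull (λ n → u n - L) → IsNull (λ n → v n - K) →
    IsNull (λ n → u n * v n - L * K)
  IsNull-* {u} {v} {L} {K} u→L v→K = IsNull-resp-≈
    (λ n → solve 4 (λ u v L K → ((u :- L) :* (v :- K) :+ L :* (v :- K)) :+ K :* (u :- L)
       := u :* v :- L :* K) ≈-refl (u n) (v n) L K)
    -- Tolerance 1: eventually u - L stays within 1 of 0, which is the bound required for the
    -- quadratic term.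
    (IsNull-+ (IsNull-+ (IsNull-bounded-* 0 (eventually-< u→L (fromℕ 1) (0<fromℕ 0)) v→K)
                        (constant-* L v→K))
              (constant-* K u→L))
    where
    constant-* : ∀ x {w} → IsNull w → IsNull (λ n → x * w n)
    constant-* x = IsNull-bounded-* (proj₁ (bound x)) (0 , λ _ _ → proj₂ (bound x))

-- The ring of complex numbers, cancellation and norm bounds

module ComplexProperties {c ℓ₁ ℓ₂} (R : RealNumbers c ℓ₁ ℓ₂) where
  open RealNumbers R renaming (Carrier to ℝ)
  open RealProperties R public
  open Complex R public
  open IntegerSolver commutativeRing

  infix 8 -ᶜ_
  -ᶜ_ : ℂ → ℂ
  -ᶜ_ = RawRing.-_ ℂ-rawRing

  ℂ-isCommutativeRing : IsCommutativeRing _≈ᶜ_ _+ᶜ_ _*ᶜ_ -ᶜ_ 0ᶜ 1ᶜ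
  ℂ-isCommutativeRing = record
    { isRing = record
      { +-isAbelianGroup = record
        { isGroup = record
          { isMonoid = record
            { isSemigroup = record
              { isMagma = record
                { isEquivalence = record
                  { refl  = ≈-refl , ≈-refl
                  ; sym   = λ (p , q) → ≈-sym p , ≈-sym q
                  ; trans = λ (p , q) (r , s) → ≈-trans p r , ≈-trans q s
                  }
                ; ∙-cong = λ (p , q) (r , s) → +-cong p r , +-cong q s
                }
              ; assoc = λ _ _ _ → +-assoc _ _ _ , +-assoc _ _ _
              }
            ; identity = (λ _ → +-identityˡ _ , +-identityˡ _) , (λ _ → +-identityʳ _ , +-identityʳ _)
            }
          ; inverse = (λ _ → -‿inverseˡ _ , -‿inverseˡ _) , (λ _ → -‿inverseʳ _ , -‿inverseʳ _)
          ; ⁻¹-cong = λ (p , q) → -‿cong p , -‿cong q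
          }
        ; comm = λ _ _ → +-comm _ _ , +-comm _ _
        }
      ; *-cong = λ (p , q) (r , s) →
          +-cong (*-cong p r) (-‿cong (*-cong q s)) , +-cong (*-cong p s) (*-cong q r)
      ; *-assoc = λ (a , b) (c , d) (e , f) →
          solve 6 (λ a b c d e f → (a :* c :- b :* d) :* e :- (a :* d :+ b :* c) :* f
            := a :* (c :* e :- d :* f) :- b :* (c :* f :+ d :* e)) ≈-refl a b c d e f ,
          solve 6 (λ a b c d e f → (a :* c :- b :* d) :* f :+ (a :* d :+ b :* c) :* e
            := a :* (c :* f :+ d :* e) :+ b :* (c :* e :- d :* f)) ≈-refl a b c d e f
      ; *-identity =
          (λ (a , b) → solve 2 (λ a b → :1 :* a :- :0 :* b := a) ≈-refl a b ,
                       solve 2 (λ a b → :1 :* b :+ :0 :* a := b) ≈-refl a b) ,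
          (λ (a , b) → solve 2 (λ a b → a :* :1 :- b :* :0 := a) ≈-refl a b ,
                       solve 2 (λ a b → a :* :0 :+ b :* :1 := b) ≈-refl a b)
      ; distrib =
          (λ (a , b) (c , d) (e , f) →
            solve 6 (λ a b c d e f → a :* (c :+ e) :- b :* (d :+ f)
              := (a :* c :- b :* d) :+ (a :* e :- b :* f)) ≈-refl a b c d e f ,
            solve 6 (λ a b c d e f → a :* (d :+ f) :+ b :* (c :+ e)
              := (a :* d :+ b :* c) :+ (a :* f :+ b :* e)) ≈-refl a b c d e f) ,
          (λ (a , b) (c , d) (e , f) →
            solve 6 (λ a b c d e f → (c :+ e) :* a :- (d :+ f) :* b
              := (c :* a :- d :* b) :+ (e :* a :- f :* b)) ≈-refl a b c d e f ,
            solve 6 (λ a b c d e f → (c :+ e) :* b :+ (d :+ f) :* a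
              := (c :* b :+ d :* a) :+ (e :* b :+ f :* a)) ≈-refl a b c d e f)
      }
    ; *-comm = λ (a , b) (c , d) →
        solve 4 (λ a b c d → a :* c :- b :* d := c :* a :- d :* b) ≈-refl a b c d ,
        solve 4 (λ a b c d → a :* d :+ b :* c := c :* b :+ d :* a) ≈-refl a b c d
    }

  ℂ-commutativeRing : CommutativeRing c ℓ₁
  ℂ-commutativeRing = record { isCommutativeRing = ℂ-isCommutativeRing }

  module ℂ = CommutativeRing ℂ-commutativeRing

  fromℝ-+ : ∀ x y → fromℝ (x + y) ≈ᶜ fromℝ x +ᶜ fromℝ y
  fromℝ-+ x y = ≈-refl , ≈-sym (+-identityˡ 0#)

  fromℝ-* : ∀ x y → fromℝ (x * y) ≈ᶜ fromℝ x *ᶜ fromℝ y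
  fromℝ-* x y =
    solve 2 (λ x y → x :* y := x :* y :- :0 :* :0) ≈-refl x y ,
    solve 2 (λ x y → :0 := x :* :0 :+ :0 :* y) ≈-refl x y

  -- If one component were apart from 0, its square would be positive and the square of the other
  -- negative.
  sum-squares≈0⇒≈0 : ∀ z → Re z * Re z + Im z * Im z ≈ 0# → z ≈ᶜ 0ᶜ
  sum-squares≈0⇒≈0 (x , y) x²+y²≈0 =
    ¬#⇒≈ (λ x#0 → 0≤-square y (<-of x#0 x²+y²≈0)) ,
    ¬#⇒≈ (λ y#0 → 0≤-square x (<-of y#0 (≈-trans (+-comm _ _) x²+y²≈0)))
    where
    <-of : ∀ {u v} → u # 0# → u * u + v ≈ 0# → v < 0#
    <-of {u} {v} u#0 u²+v≈0 = 0<-⇒< (<-respʳ-≈ u²≈0-v (#0⇒0<square u#0))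
      where
      u²≈0-v : u * u ≈ 0# - v
      u²≈0-v = ≈-trans (solve 2 (λ u v → u :* u := (u :* u :+ v) :- v) ≈-refl u v) (+-congʳ u²+v≈0)

  -- Multiplying zw = 0 by the conjugate of z gives u|z|² = v|z|² = 0 for w = u + iv. If u were
  -- apart from 0, then |z|² = 0 and z = 0, a contradiction; so u = 0 by tightness, and likewise v =
  -- 0. Since the conclusion is itself proved by contradiction, a merely negated hypothesis on z
  -- suffices.
  *ᶜ-cancel-≉0 : ∀ z w → z *ᶜ w ≈ᶜ 0ᶜ → ¬ (z ≈ᶜ 0ᶜ) → w ≈ᶜ 0ᶜ
  *ᶜ-cancel-≉0 z@(x , y) w@(u , v) (re≈0 , im≈0) z≉0 =
    ¬#⇒≈ (λ u#0 → z≉0 (sum-squares≈0⇒≈0 z (*≈0∧#0⇒≈0 {u} eqᵤ u#0))) ,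
    ¬#⇒≈ (λ v#0 → z≉0 (sum-squares≈0⇒≈0 z (*≈0∧#0⇒≈0 {v} eqᵥ v#0)))
    where
    combine : ∀ {a b} p q → a ≈ 0# → b ≈ 0# → p * a + q * b ≈ 0#
    combine p q a≈0 b≈0 = ≈-trans (+-cong (*-congˡ a≈0) (*-congˡ b≈0))
      (solve 2 (λ p q → p :* :0 :+ q :* :0 := :0) ≈-refl p q)
    eqᵤ : u * (x * x + y * y) ≈ 0#
    eqᵤ = ≈-trans
      (solve 4 (λ x y u v → u :* (x :* x :+ y :* y)
        := x :* (x :* u :- y :* v) :+ y :* (x :* v :+ y :* u)) ≈-refl x y u v)
      (combine x y re≈0 im≈0)
    eqᵥ : v * (x * x + y * y) ≈ 0#
    eqᵥ = ≈-trans
      (solve 4 (λ x y u v → v :* (x :* x :+ y :* y)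
        := x :* (x :* v :+ y :* u) :+ (:- y) :* (x :* u :- y :* v)) ≈-refl x y u v)
      (combine x (- y) im≈0 re≈0)

  conj : ℂ → ℂ
  conj (x , y) = x , - y

  -- z ⊑ B bounds the norm ∣ Re z ∣ + ∣ Im z ∣ by B; no absolute value is
  -- available constructively, so the two summands are bounded separately.
  infix 4 _⊑_
  record _⊑_ (z : ℂ) (B : ℝ) : Set (c ⊔ ℓ₂) where
    field
      reBound imBound : ℝ
      re-upper : 0≤ (reBound - Re z)
      re-lower : 0≤ (reBound + Re z)
      im-upper : 0≤ (imBound - Im z)
      im-lower : 0≤ (imBound + Im z)
      bounded  : 0≤ (B - (reBound + imBound))

    0≤reBound : 0≤ reBound
    0≤reBound = 0≤-halve (0≤-resp-≈
      (solve 2 (λ a x → (a :- x) :+ (a :+ x) := a :+ a) ≈-refl reBound (Re z)) (0≤-+ re-upper re-lower))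

    0≤imBound : 0≤ imBound
    0≤imBound = 0≤-halve (0≤-resp-≈
      (solve 2 (λ a x → (a :- x) :+ (a :+ x) := a :+ a) ≈-refl imBound (Im z)) (0≤-+ im-upper im-lower))

    ⊑⇒0≤ : 0≤ B
    ⊑⇒0≤ = 0≤-resp-≈ (solve 3 (λ a b B → (B :- (a :+ b)) :+ (a :+ b) := B) ≈-refl reBound imBound B)
      (0≤-+ bounded (0≤-+ 0≤reBound 0≤imBound))

    Re-upper : 0≤ (B - Re z)
    Re-upper = 0≤-resp-≈
      (solve 4 (λ a b B x → ((B :- (a :+ b)) :+ b) :+ (a :- x) := B :- x) ≈-refl reBound imBound B (Re z))
      (0≤-+ (0≤-+ bounded 0≤imBound) re-upper)

    Re-lower : 0≤ (B + Re z)
    Re-lower = 0≤-resp-≈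
      (solve 4 (λ a b B x → ((B :- (a :+ b)) :+ b) :+ (a :+ x) := B :+ x) ≈-refl reBound imBound B (Re z))
      (0≤-+ (0≤-+ bounded 0≤imBound) re-lower)

    Im-upper : 0≤ (B - Im z)
    Im-upper = 0≤-resp-≈
      (solve 4 (λ a b B x → ((B :- (a :+ b)) :+ a) :+ (b :- x) := B :- x) ≈-refl reBound imBound B (Im z))
      (0≤-+ (0≤-+ bounded 0≤reBound) im-upper)

    Im-lower : 0≤ (B + Im z)
    Im-lower = 0≤-resp-≈
      (solve 4 (λ a b B x → ((B :- (a :+ b)) :+ a) :+ (b :+ x) := B :+ x) ≈-refl reBound imBound B (Im z))
      (0≤-+ (0≤-+ bounded 0≤reBound) im-lower)

  ⊑-mono : ∀ {z w B C} → z ≈ᶜ w → 0≤ (C - B) → z ⊑ B → w ⊑ C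
  ⊑-mono {B = B} {C} (re≈ , im≈) B≤C z⊑B = record
    { reBound  = reBound
    ; imBound  = imBound
    ; re-upper = 0≤-resp-≈ (+-congˡ (-‿cong re≈)) re-upper
    ; re-lower = 0≤-resp-≈ (+-congˡ re≈) re-lower
    ; im-upper = 0≤-resp-≈ (+-congˡ (-‿cong im≈)) im-upper
    ; im-lower = 0≤-resp-≈ (+-congˡ im≈) im-lower
    ; bounded  = 0≤-resp-≈
        (solve 3 (λ B C s → (C :- B) :+ (B :- s) := C :- s) ≈-refl B C (reBound + imBound))
        (0≤-+ B≤C bounded)
    }
    where open _⊑_ z⊑B

  ⊑-resp-≈ : ∀ {z w B C} → z ≈ᶜ w → B ≈ C → z ⊑ B → w ⊑ C
  ⊑-resp-≈ {B = B} z≈w B≈C = ⊑-mono z≈w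
    (0≤-resp-≈ (≈-trans (≈-sym (-‿inverseʳ B)) (+-congʳ B≈C)) 0≤0)

  ⊑-fromℝ : ∀ {x} → 0≤ x → fromℝ x ⊑ x
  ⊑-fromℝ {x} 0≤x = record
    { reBound  = x
    ; imBound  = 0#
    ; re-upper = 0≤-resp-≈ (≈-sym (-‿inverseʳ x)) 0≤0
    ; re-lower = 0≤-+ 0≤x 0≤x
    ; im-upper = 0≤-resp-≈ (≈-sym (-‿inverseʳ 0#)) 0≤0
    ; im-lower = 0≤-+ 0≤0 0≤0
    ; bounded  = 0≤-resp-≈ (solve 1 (λ x → :0 := x :- (x :+ :0)) ≈-refl x) 0≤0
    }

  ⊑-+ : ∀ {z w B C} → z ⊑ B → w ⊑ C → z +ᶜ w ⊑ B + C
  ⊑-+ {z} {w} {B} {C} z⊑B w⊑C = record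
    { reBound  = Z.reBound + W.reBound
    ; imBound  = Z.imBound + W.imBound
    ; re-upper = 0≤-resp-≈ (difference Z.reBound W.reBound (Re z) (Re w)) (0≤-+ Z.re-upper W.re-upper)
    ; re-lower = 0≤-resp-≈ (total Z.reBound W.reBound (Re z) (Re w)) (0≤-+ Z.re-lower W.re-lower)
    ; im-upper = 0≤-resp-≈ (difference Z.imBound W.imBound (Im z) (Im w)) (0≤-+ Z.im-upper W.im-upper)
    ; im-lower = 0≤-resp-≈ (total Z.imBound W.imBound (Im z) (Im w)) (0≤-+ Z.im-lower W.im-lower)
    ; bounded  = 0≤-resp-≈
        (solve 6 (λ B C a b d e → (B :- (a :+ b)) :+ (C :- (d :+ e)) := (B :+ C) :- ((a :+ d) :+ (b :+ e)))
          ≈-refl B C Z.reBound Z.imBound W.reBound W.imBound)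
        (0≤-+ Z.bounded W.bounded)
    }
    where
    module Z = _⊑_ z⊑B
    module W = _⊑_ w⊑C
    difference : ∀ a b x y → (a - x) + (b - y) ≈ (a + b) - (x + y)
    difference = solve 4 (λ a b x y → (a :- x) :+ (b :- y) := (a :+ b) :- (x :+ y)) ≈-refl
    total : ∀ a b x y → (a + x) + (b + y) ≈ (a + b) + (x + y)
    total = solve 4 (λ a b x y → (a :+ x) :+ (b :+ y) := (a :+ b) :+ (x :+ y)) ≈-refl

  module _ {a b x y : ℝ}
    (x≤a : 0≤ (a - x)) (-a≤x : 0≤ (a + x)) (y≤b : 0≤ (b - y)) (-b≤y : 0≤ (b + y)) where

    -- The identity of ∣∣<-*, with weak inequalities.
    *-upper : 0≤ (a * b - x * y)
    *-upper = 0≤-halve (0≤-resp-≈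
      (solve 4 (λ a b x y → (a :- x) :* (b :+ y) :+ (a :+ x) :* (b :- y)
        := (a :* b :- x :* y) :+ (a :* b :- x :* y)) ≈-refl a b x y)
      (0≤-+ (0≤-* x≤a -b≤y) (0≤-* -a≤x y≤b)))

    *-lower : 0≤ (a * b + x * y)
    *-lower = 0≤-halve (0≤-resp-≈
      (solve 4 (λ a b x y → (a :- x) :* (b :- y) :+ (a :+ x) :* (b :+ y)
        := (a :* b :+ x :* y) :+ (a :* b :+ x :* y)) ≈-refl a b x y)
      (0≤-+ (0≤-* x≤a y≤b) (0≤-* -a≤x -b≤y)))

  -- The norm |Re| + |Im| is submultiplicative: the products ad, be, ae and bd that bound the two
  -- components add up to (a + b)(d + e).
  ⊑-* : ∀ {z w B C} → z ⊑ B → w ⊑ C → z *ᶜ w ⊑ B * C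
  ⊑-* {z} {w} {B} {C} z⊑B w⊑C = record
    { reBound  = a * d + b * e
    ; imBound  = a * e + b * d
    ; re-upper = 0≤-resp-≈ (solve 4 (λ p q r s → (p :- r) :+ (q :+ s) := (p :+ q) :- (r :- s)) ≈-refl
                   (a * d) (b * e) (Re z * Re w) (Im z * Im w))
                 (0≤-+ (*-upper Z.re-upper Z.re-lower W.re-upper W.re-lower)
                       (*-lower Z.im-upper Z.im-lower W.im-upper W.im-lower))
    ; re-lower = 0≤-resp-≈ (solve 4 (λ p q r s → (p :+ r) :+ (q :- s) := (p :+ q) :+ (r :- s)) ≈-refl
                   (a * d) (b * e) (Re z * Re w) (Im z * Im w))
                 (0≤-+ (*-lower Z.re-upper Z.re-lower W.re-upper W.re-lower)
                       (*-upper Z.im-upper Z.im-lower W.im-upper W.im-lower))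
    ; im-upper = 0≤-resp-≈ (solve 4 (λ p q r s → (p :- r) :+ (q :- s) := (p :+ q) :- (r :+ s)) ≈-refl
                   (a * e) (b * d) (Re z * Im w) (Im z * Re w))
                 (0≤-+ (*-upper Z.re-upper Z.re-lower W.im-upper W.im-lower)
                       (*-upper Z.im-upper Z.im-lower W.re-upper W.re-lower))
    ; im-lower = 0≤-resp-≈ (solve 4 (λ p q r s → (p :+ r) :+ (q :+ s) := (p :+ q) :+ (r :+ s)) ≈-refl
                   (a * e) (b * d) (Re z * Im w) (Im z * Re w))
                 (0≤-+ (*-lower Z.re-upper Z.re-lower W.im-upper W.im-lower)
                       (*-lower Z.im-upper Z.im-lower W.re-upper W.re-lower))
    ; bounded  = 0≤-resp-≈
        (solve 6 (λ B C a b d e → (B :- (a :+ b)) :* C :+ (a :+ b) :* (C :- (d :+ e))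
          := B :* C :- ((a :* d :+ b :* e) :+ (a :* e :+ b :* d))) ≈-refl B C a b d e)
        (0≤-+ (0≤-* Z.bounded W.⊑⇒0≤) (0≤-* (0≤-+ Z.0≤reBound Z.0≤imBound) W.bounded))
    }
    where
    module Z = _⊑_ z⊑B
    module W = _⊑_ w⊑C
    a = Z.reBound
    b = Z.imBound
    d = W.reBound
    e = W.imBound

  ∃-⊑ : ∀ z → ∃[ B ] (z ⊑ B)
  ∃-⊑ (x , y) = fromℕ (suc (proj₁ (bound x))) + fromℕ (suc (proj₁ (bound y))) , record
    { reBound  = fromℕ (suc (proj₁ (bound x)))
    ; imBound  = fromℕ (suc (proj₁ (bound y)))
    ; re-upper = <⇒0≤ (<⇒0<- (upper (proj₂ (bound x))))
    ; re-lower = below (proj₂ (bound x))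
    ; im-upper = <⇒0≤ (<⇒0<- (upper (proj₂ (bound y))))
    ; im-lower = below (proj₂ (bound y))
    ; bounded  = 0≤-resp-≈ (≈-sym (-‿inverseʳ _)) 0≤0
    }
    where
    below : ∀ {x a} → ∣ x ∣< a → 0≤ (a + x)
    below {x} {a} ∣x∣<a = <⇒0≤ (<-respʳ-≈
      (solve 2 (λ a x → a :- (:- x) := a :+ x) ≈-refl a x) (<⇒0<- (lower ∣x∣<a)))

-- Domination of complex exponential sums by real ones

module ExponentialProperties {c ℓ₁ ℓ₂} (R : RealNumbers c ℓ₁ ℓ₂) where
  open RealNumbers R renaming (Carrier to ℝ)
  open ComplexProperties R
  open IntegerSolver commutativeRing
  open SemiringMult (CommutativeRing.semiring ℂ-commutativeRing) using () renaming (_×_ to _·ᶜ_)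
  open SemiringExp (CommutativeRing.semiring commutativeRing) using (_^_)
  module Sℝ = PowerSeries commutativeRing
  module Sℂ = PowerSeries ℂ-commutativeRing

  partialSum-⊑ : ∀ {a A} → (∀ n → a n ⊑ A n) → ∀ n → Sℂ.partialSum a n ⊑ Sℝ.partialSum A n
  partialSum-⊑ a⊑A zero    = ⊑-fromℝ 0≤0
  partialSum-⊑ a⊑A (suc n) = ⊑-+ (a⊑A 0) (partialSum-⊑ (a⊑A ∘ suc) n)

  tail-⊑ : ∀ {a A} → (∀ n → a n ⊑ A n) → ∀ {p n} → p ℕ.≤ n →
    Sℂ.partialSum a n ℂ.- Sℂ.partialSum a p ⊑ Sℝ.partialSum A n - Sℝ.partialSum A p
  tail-⊑ {a} {A} a⊑A {n = n} z≤n = ⊑-resp-≈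
    (ℂ.sym (Sℂ.-0#-identityʳ (Sℂ.partialSum a n))) (≈-sym (Sℝ.-0#-identityʳ _)) (partialSum-⊑ a⊑A n)
  tail-⊑ {a} {A} a⊑A {suc p} {suc n} (s≤s p≤n) = ⊑-resp-≈
    (ℂ.sym (Sℂ.partialSum-suc-difference a n p)) (≈-sym (Sℝ.partialSum-suc-difference A n p))
    (tail-⊑ (a⊑A ∘ suc) p≤n)

  -- Since p is at most m and n, the triangle lies inside the rectangle. The difference is a sum
  -- over the remaining index pairs, so termwise domination carries over to it.
  rectangle-triangle-⊑ : ∀ {a A b B} → (∀ n → a n ⊑ A n) → (∀ n → b n ⊑ B n) →
    ∀ {p m n} → p ℕ.≤ m → p ℕ.≤ n →
    Sℂ.partialSum a m *ᶜ Sℂ.partialSum b n ℂ.- Sℂ.triangle a b p ⊑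
    Sℝ.partialSum A m * Sℝ.partialSum B n - Sℝ.triangle A B p
  rectangle-triangle-⊑ {a} {A} {b} {B} a⊑A b⊑B {zero} {m} {n} _ _ = ⊑-resp-≈
    (ℂ.sym (Sℂ.-0#-identityʳ (Sℂ.partialSum a m *ᶜ Sℂ.partialSum b n))) (≈-sym (Sℝ.-0#-identityʳ _))
    (⊑-* (partialSum-⊑ a⊑A m) (partialSum-⊑ b⊑B n))
  rectangle-triangle-⊑ {a} {A} {b} {B} a⊑A b⊑B {suc p} {suc m} {n} (s≤s p≤m) p<n = ⊑-resp-≈
    (ℂ.sym (Sℂ.rectangle-triangle-suc a b m n p)) (≈-sym (Sℝ.rectangle-triangle-suc A B m n p))
    (⊑-+ (⊑-* (a⊑A 0) (tail-⊑ b⊑B p<n))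
         (rectangle-triangle-⊑ (a⊑A ∘ suc) b⊑B p≤m (ℕ.<⇒≤ p<n)))

  0≤partialSum : ∀ {A} → (∀ n → 0≤ A n) → ∀ n → 0≤ Sℝ.partialSum A n
  0≤partialSum 0≤A zero    = 0≤0
  0≤partialSum 0≤A (suc n) = 0≤-+ (0≤A 0) (0≤partialSum (0≤A ∘ suc) n)

  0≤tail : ∀ {A} → (∀ n → 0≤ A n) → ∀ {p n} → p ℕ.≤ n →
    0≤ (Sℝ.partialSum A n - Sℝ.partialSum A p)
  0≤tail {A} 0≤A {n = n} z≤n = 0≤-resp-≈ (≈-sym (Sℝ.-0#-identityʳ _)) (0≤partialSum 0≤A n)
  0≤tail {A} 0≤A {suc p} {suc n} (s≤s p≤n) =
    0≤-resp-≈ (≈-sym (Sℝ.partialSum-suc-difference A n p)) (0≤tail (0≤A ∘ suc) p≤n)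

  0≤triangle : ∀ {A B} → (∀ n → 0≤ A n) → (∀ n → 0≤ B n) → ∀ n → 0≤ Sℝ.triangle A B n
  0≤triangle 0≤A 0≤B zero    = 0≤0
  0≤triangle 0≤A 0≤B (suc n) =
    0≤-+ (0≤-* (0≤A 0) (0≤partialSum 0≤B (suc n))) (0≤triangle (0≤A ∘ suc) 0≤B n)

  -- For m + n at most q the rectangle of index pairs lies inside the triangle i + j < q, and no
  -- term is negative.
  rectangle≤triangle : ∀ {A B} → (∀ n → 0≤ A n) → (∀ n → 0≤ B n) → ∀ {m n q} → m ℕ.+ n ℕ.≤ q →
    0≤ (Sℝ.triangle A B q - Sℝ.partialSum A m * Sℝ.partialSum B n)
  rectangle≤triangle {A} {B} 0≤A 0≤B {zero} {n} {q} _ = 0≤-resp-≈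
    (solve 2 (λ t x → t := t :- :0 :* x) ≈-refl (Sℝ.triangle A B q) (Sℝ.partialSum B n))
    (0≤triangle 0≤A 0≤B q)
  rectangle≤triangle {A} {B} 0≤A 0≤B {suc m} {n} {suc q} (s≤s m+n≤q) = 0≤-resp-≈
    (≈-trans
      (solve 4 (λ x B B′ d → x :* (B′ :- B) :+ (:- d) := :- (x :* (B :- B′) :+ d)) ≈-refl
        (A 0) (Sℝ.partialSum B n) (Sℝ.partialSum B (suc q)) (P * Sℝ.partialSum B n - T))
      (≈-trans (-‿cong (≈-sym (Sℝ.rectangle-triangle-suc A B m n q)))
        (negate-difference _ _)))
    (0≤-+ (0≤-* (0≤A 0) (0≤tail 0≤B (ℕ.m≤n⇒m≤1+n (ℕ.≤-trans (ℕ.m≤n+m n m) m+n≤q))))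
          (0≤-resp-≈ (≈-sym (negate-difference (P * Sℝ.partialSum B n) T))
            (rectangle≤triangle (0≤A ∘ suc) 0≤B {m} m+n≤q)))
    where
    P = Sℝ.partialSum (A ∘ suc) m
    T = Sℝ.triangle (A ∘ suc) B q
    negate-difference : ∀ x y → - (x - y) ≈ y - x
    negate-difference = solve 2 (λ x y → :- (x :- y) := y :- x) ≈-refl

  1/_!ℝ : ℕ → ℝ
  1/ n !ℝ = 1/_ (n !) {{n !≢0}}

  1/0!≈1 : 1/ 0 !ℝ ≈ 1#
  1/0!≈1 = ≈-sym (1/-unique 1 (≈-trans (*-identityʳ (fromℕ 1)) (+-identityʳ 1#)))

  1/-suc-!ℝ : ∀ n → fromℕ (suc n) * 1/ suc n !ℝ ≈ 1/ n !ℝ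
  1/-suc-!ℝ n = *-1/-* (suc n) (n !) {{n !≢0}} {{suc n !≢0}}

  fromℝ-fromℕ : ∀ n → n ·ᶜ 1ᶜ ≈ᶜ fromℝ (fromℕ n)
  fromℝ-fromℕ zero    = ℂ.refl
  fromℝ-fromℕ (suc n) = ℂ.trans (ℂ.+-congˡ {1ᶜ} (fromℝ-fromℕ n)) (ℂ.sym (fromℝ-+ 1# (fromℕ n)))

  fromℝ-cong : ∀ {x y} → x ≈ y → fromℝ x ≈ᶜ fromℝ y
  fromℝ-cong x≈y = x≈y , ≈-refl

  ·ᶜ-*-fromℝ : ∀ n x → (n ·ᶜ 1ᶜ) *ᶜ fromℝ x ≈ᶜ fromℝ (fromℕ n * x)
  ·ᶜ-*-fromℝ n x = ℂ.trans (ℂ.*-congʳ {fromℝ x} (fromℝ-fromℕ n)) (ℂ.sym (fromℝ-* (fromℕ n) x))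

  module Eℝ = Sℝ.Exponential (λ n → 1/ suc n) 1/_!ℝ (λ n → *-inverse-fromℕ (suc n)) 1/0!≈1 1/-suc-!ℝ
  module Eℂ = Sℂ.Exponential (λ n → fromℝ (1/ suc n)) (λ n → fromℝ 1/ n !ℝ)
    (λ n → ℂ.trans (·ᶜ-*-fromℝ (suc n) (1/ suc n)) (fromℝ-cong (*-inverse-fromℕ (suc n))))
    (fromℝ-cong 1/0!≈1)
    (λ n → ℂ.trans (·ᶜ-*-fromℝ (suc n) 1/ suc n !ℝ) (fromℝ-cong (1/-suc-!ℝ n)))

  ^-⊑ : ∀ {z B} → z ⊑ B → ∀ n → z ^ᶜ n ⊑ B ^ n
  ^-⊑ z⊑B zero    = ⊑-fromℝ (<⇒0≤ 0<1)
  ^-⊑ z⊑B (suc n) = ⊑-* z⊑B (^-⊑ z⊑B n)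

  0≤1/! : ∀ n → 0≤ 1/ n !ℝ
  0≤1/! n = <⇒0≤ (0<1/ (n !) {{n !≢0}})

  term-⊑ : ∀ {z B} → z ⊑ B → ∀ n → Eℂ.term z n ⊑ Eℝ.term B n
  term-⊑ z⊑B n = ⊑-* (^-⊑ z⊑B n) (⊑-fromℝ (0≤1/! n))

  expPartialSumℝ : ℝ → ℕ → ℝ
  expPartialSumℝ x n = Sℝ.partialSum (Eℝ.term x) n

  fromℝ-^ : ∀ x n → fromℝ x ^ᶜ n ≈ᶜ fromℝ (x ^ n)
  fromℝ-^ x zero    = ℂ.refl
  fromℝ-^ x (suc n) = ℂ.trans (ℂ.*-congˡ {fromℝ x} (fromℝ-^ x n)) (ℂ.sym (fromℝ-* x (x ^ n)))

  fromℝ-partialSum : ∀ {a A} → (∀ n → a n ≈ᶜ fromℝ (A n)) →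
    ∀ n → Sℂ.partialSum a n ≈ᶜ fromℝ (Sℝ.partialSum A n)
  fromℝ-partialSum a≈A zero    = ℂ.refl
  fromℝ-partialSum {A = A} a≈A (suc n) =
    ℂ.trans (ℂ.+-cong (a≈A 0) (fromℝ-partialSum (a≈A ∘ suc) n)) (ℂ.sym (fromℝ-+ (A 0) _))

  expPartialSum-fromℝ : ∀ x n → expPartialSum (fromℝ x) n ≈ᶜ fromℝ (expPartialSumℝ x n)
  expPartialSum-fromℝ x = fromℝ-partialSum λ n →
    ℂ.trans (ℂ.*-congʳ {fromℝ 1/ n !ℝ} (fromℝ-^ x n)) (ℂ.sym (fromℝ-* (x ^ n) 1/ n !ℝ))

  -- E_n(z)E_n(w) - E_n(z + w) consists of the terms zⁱwʲ/i!j! with i, j < n ≤ i + j,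
  -- which are dominated by the corresponding ones for B and C, and i + j < 2n.
  expPartialSum-+-⊑ : ∀ {z w B C} → z ⊑ B → w ⊑ C → ∀ n →
    expPartialSum z n *ᶜ expPartialSum w n ℂ.- expPartialSum (z +ᶜ w) n ⊑
    expPartialSumℝ (B + C) (n ℕ.+ n) - expPartialSumℝ (B + C) n
  expPartialSum-+-⊑ {z} {w} {B} {C} z⊑B w⊑C n = ⊑-mono
    (ℂ.+-congˡ {expPartialSum z n *ᶜ expPartialSum w n} (ℂ.-‿cong (Eℂ.triangle-term z w n)))
    (0≤-resp-≈
      (≈-trans (+-congʳ (Eℝ.triangle-term B C (n ℕ.+ n)))
        (≈-trans (solve 3 (λ e r t → e :- r := (e :- t) :- (r :- t)) ≈-refl
                   (expPartialSumℝ (B + C) (n ℕ.+ n)) rectangle (Sℝ.triangle (Eℝ.term B) (Eℝ.term C) n))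
          (+-congʳ (+-congˡ (-‿cong (Eℝ.triangle-term B C n))))))
      (rectangle≤triangle (0≤term z⊑B) (0≤term w⊑C) {n} ℕ.≤-refl))
    (rectangle-triangle-⊑ (term-⊑ z⊑B) (term-⊑ w⊑C) {n} ℕ.≤-refl ℕ.≤-refl)
    where
    rectangle = expPartialSumℝ B n * expPartialSumℝ C n
    0≤term : ∀ {z B} → z ⊑ B → ∀ n → 0≤ Eℝ.term B n
    0≤term z⊑B n = _⊑_.⊑⇒0≤ (term-⊑ z⊑B n)

-- Limits, the addition formula and the unit circle

module ComplexExponential {c ℓ₁ ℓ₂} (R : RealNumbers c ℓ₁ ℓ₂)
  (exp : Complex.ℂ R → Complex.ℂ R) (isExp : Complex.IsExp R exp) where
  open RealNumbers R renaming (Carrier to ℝ; zero to *-zero)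
  open ComplexProperties R
  open ExponentialProperties R
  open IntegerSolver commutativeRing
  open SemiringExp ℂ.semiring using (^-congˡ)

  IsNull-squeeze : ∀ {u r} → (∀ n → 0≤ (r n - u n)) → (∀ n → 0≤ (r n + u n)) → IsNull r → IsNull u
  IsNull-squeeze {u} {r} u≤r -r≤u (null r→0) = null λ ε 0<ε → let (N , p) = r→0 ε 0<ε in
    N , λ n N≤n → 0≤-<-trans (u≤r n) (upper (p n N≤n)) ∧
      0≤-<-trans (0≤-resp-≈ (solve 2 (λ r u → r :+ u := r :- (:- u)) ≈-refl (r n) (u n)) (-r≤u n))
        (upper (p n N≤n))

  IsNull-∘ : ∀ {u} (f : ℕ → ℕ) → (∀ n → n ℕ.≤ f n) → IsNull u → IsNull (u ∘ f)
  IsNull-∘ f n≤fn (null u→0) = null λ ε 0<ε → let (N , p) = u→0 ε 0<ε in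
    N , λ n N≤n → p (f n) (ℕ.≤-trans N≤n (n≤fn n))

  IsNull-0 : IsNull (λ _ → 0#)
  IsNull-0 = null λ ε 0<ε → 0 , λ _ _ → 0<ε ∧ <-respˡ-≈ (solve 0 (:0 := :- :0) ≈-refl) 0<ε

  infix 4 _⇢_
  record _⇢_ (u : ℕ → ℂ) (L : ℂ) : Set (c ⊔ ℓ₂) where
    constructor _∧_
    field
      re : IsNull (λ n → Re (u n) - Re L)
      im : IsNull (λ n → Im (u n) - Im L)

  ⇢-resp-≈ : ∀ {u v L K} → (∀ n → u n ≈ᶜ v n) → L ≈ᶜ K → u ⇢ L → v ⇢ K
  ⇢-resp-≈ u≈v (re≈ , im≈) (p ∧ q) =
    IsNull-resp-≈ (λ n → +-cong (proj₁ (u≈v n)) (-‿cong re≈)) p ∧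
    IsNull-resp-≈ (λ n → +-cong (proj₂ (u≈v n)) (-‿cong im≈)) q

  ⇢-unique : ∀ {u L K} → u ⇢ L → u ⇢ K → L ≈ᶜ K
  ⇢-unique (p ∧ q) (r ∧ s) = IsNull-unique p r , IsNull-unique q s

  ⇢-const : ∀ L → (λ _ → L) ⇢ L
  ⇢-const L = IsNull-resp-≈ (λ _ → ≈-sym (-‿inverseʳ _)) IsNull-0 ∧
              IsNull-resp-≈ (λ _ → ≈-sym (-‿inverseʳ _)) IsNull-0

  ⇢-+ : ∀ {u v L K} → u ⇢ L → v ⇢ K → (λ n → u n +ᶜ v n) ⇢ (L +ᶜ K)
  ⇢-+ {u} {v} {L} {K} (p ∧ q) (r ∧ s) =
    IsNull-resp-≈ (λ n → regroup (Re (u n)) (Re L) (Re (v n)) (Re K)) (IsNull-+ p r) ∧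
    IsNull-resp-≈ (λ n → regroup (Im (u n)) (Im L) (Im (v n)) (Im K)) (IsNull-+ q s)
    where
    regroup : ∀ u L v K → (u - L) + (v - K) ≈ (u + v) - (L + K)
    regroup = solve 4 (λ u L v K → (u :- L) :+ (v :- K) := (u :+ v) :- (L :+ K)) ≈-refl

  ⇢-* : ∀ {u v L K} → u ⇢ L → v ⇢ K → (λ n → u n *ᶜ v n) ⇢ (L *ᶜ K)
  ⇢-* {u} {v} {L} {K} (p ∧ q) (r ∧ s) =
    IsNull-resp-≈ (λ n → solve 4 (λ a b c d → (a :- b) :+ (:- (c :- d)) := (a :- c) :- (b :- d)) ≈-refl
        (Re (u n) * Re (v n)) (Re L * Re K) (Im (u n) * Im (v n)) (Im L * Im K))
      (IsNull-+ (IsNull-* p r) (IsNull-neg (IsNull-* q s))) ∧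
    IsNull-resp-≈ (λ n → solve 4 (λ a b c d → (a :- b) :+ (c :- d) := (a :+ c) :- (b :+ d)) ≈-refl
        (Re (u n) * Im (v n)) (Re L * Im K) (Im (u n) * Re (v n)) (Im L * Re K))
      (IsNull-+ (IsNull-* p s) (IsNull-* q r))

  ⇢-conj : ∀ {u L} → u ⇢ L → (conj ∘ u) ⇢ conj L
  ⇢-conj {u} {L} (p ∧ q) = p ∧ IsNull-resp-≈
    (λ n → solve 2 (λ x y → :- (x :- y) := (:- x) :- (:- y)) ≈-refl (Im (u n)) (Im L)) (IsNull-neg q)

  ⇢-exp : ∀ z → expPartialSum z ⇢ exp z
  ⇢-exp z = ⟶⇒IsNull (proj₁ (isExp z)) ∧ ⟶⇒IsNull (proj₂ (isExp z))

  exp-unique : ∀ {z L} → expPartialSum z ⇢ L → exp z ≈ᶜ L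
  exp-unique {z} = ⇢-unique (⇢-exp z)

  -- `IsExp` does not ask `exp` to respect `_≈ᶜ_`; this holds because the partial sums do and limits
  -- are unique.
  exp-cong : ∀ {z w} → z ≈ᶜ w → exp z ≈ᶜ exp w
  exp-cong {z} {w} z≈w = exp-unique
    (⇢-resp-≈ (Sℂ.partialSum-cong (λ n → ℂ.*-congʳ {fromℝ 1/ n !ℝ} (^-congˡ n (ℂ.sym z≈w)))) ℂ.refl (⇢-exp w))

  -- The real series is the real part of the complex series at `fromℝ x`, which converges by
  -- hypothesis. Hence both sequences have the same limit, and no estimate of the tail by factorials
  -- is made.
  expPartialSumℝ-Cauchy : ∀ x →
    IsNull (λ n → expPartialSumℝ x (n ℕ.+ n) - expPartialSumℝ x n)
  expPartialSumℝ-Cauchy x = IsNull-resp-≈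
    (λ n → solve 3 (λ a b L → (a :- L) :+ (:- (b :- L)) := a :- b) ≈-refl _ _ (Re (exp (fromℝ x))))
    (IsNull-+ (IsNull-∘ (λ n → n ℕ.+ n) (λ n → ℕ.m≤m+n n n) converges) (IsNull-neg converges))
    where
    converges : IsNull (λ n → expPartialSumℝ x n - Re (exp (fromℝ x)))
    converges = IsNull-resp-≈ (λ n → +-congʳ (proj₁ (expPartialSum-fromℝ x n))) (_⇢_.re (⇢-exp (fromℝ x)))

  exp-+ : ∀ z w → exp (z +ᶜ w) ≈ᶜ exp z *ᶜ exp w
  exp-+ z w = ℂ.trans (ℂ.sym (ℂ.+-identityˡ (exp (z +ᶜ w)))) (⇢-unique
    (⇢-resp-≈ (λ n → difference+ (E n) (F n)) (ℂ.refl {0ᶜ +ᶜ exp (z +ᶜ w)})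
      (⇢-+ difference→0 (⇢-exp (z +ᶜ w))))
    (⇢-* (⇢-exp z) (⇢-exp w)))
    where
    B C : ℝ
    B = proj₁ (∃-⊑ z)
    C = proj₁ (∃-⊑ w)
    E F : ℕ → ℂ
    E n = expPartialSum z n *ᶜ expPartialSum w n
    F n = expPartialSum (z +ᶜ w) n
    dominated : ∀ n → E n ℂ.- F n ⊑ expPartialSumℝ (B + C) (n ℕ.+ n) - expPartialSumℝ (B + C) n
    dominated = expPartialSum-+-⊑ (proj₂ (∃-⊑ z)) (proj₂ (∃-⊑ w))
    minus0 : ∀ x → x ≈ x - 0#
    minus0 x = ≈-sym (Sℝ.-0#-identityʳ x)
    difference→0 : (λ n → E n ℂ.- F n) ⇢ 0ᶜ
    difference→0 =
      IsNull-resp-≈ (λ n → minus0 (Re (E n ℂ.- F n)))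
        (IsNull-squeeze (λ n → _⊑_.Re-upper (dominated n)) (λ n → _⊑_.Re-lower (dominated n))
          (expPartialSumℝ-Cauchy (B + C))) ∧
      IsNull-resp-≈ (λ n → minus0 (Im (E n ℂ.- F n)))
        (IsNull-squeeze (λ n → _⊑_.Im-upper (dominated n)) (λ n → _⊑_.Im-lower (dominated n))
          (expPartialSumℝ-Cauchy (B + C)))
    difference+ : ∀ x y → (x ℂ.- y) +ᶜ y ≈ᶜ x
    difference+ (x , x′) (y , y′) = identity x y , identity x′ y′
      where
      identity : ∀ x y → (x - y) + y ≈ x
      identity = solve 2 (λ x y → (x :- y) :+ y := x) ≈-refl

  -- All terms after the zeroth vanish, so the partial sums are 1 from index 1 on. Index 0 is the
  -- empty sum 0, which `null-suc` skips.
  exp-0 : exp 0ᶜ ≈ᶜ 1ᶜ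
  exp-0 = exp-unique (tail→ (λ n → partialSum-0 n))
    where
    term-0 : ∀ n → Eℂ.term 0ᶜ (suc n) ≈ᶜ 0ᶜ
    term-0 n = ℂ.trans (ℂ.*-congʳ {fromℝ 1/ suc n !ℝ} (ℂ.zeroˡ (0ᶜ ^ᶜ n))) (ℂ.zeroˡ (fromℝ 1/ suc n !ℝ))
    zeros : ∀ {a} → (∀ n → a n ≈ᶜ 0ᶜ) → ∀ n → Sℂ.partialSum a n ≈ᶜ 0ᶜ
    zeros a≈0 zero    = ℂ.refl
    zeros a≈0 (suc n) = ℂ.trans (ℂ.+-cong (a≈0 0) (zeros (a≈0 ∘ suc) n)) (ℂ.+-identityˡ 0ᶜ)
    partialSum-0 : ∀ n → expPartialSum 0ᶜ (suc n) ≈ᶜ 1ᶜ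
    partialSum-0 n = ℂ.trans
      (ℂ.+-cong (ℂ.trans (ℂ.*-identityˡ (fromℝ 1/ 0 !ℝ)) (fromℝ-cong 1/0!≈1)) (zeros term-0 n))
      (ℂ.+-identityʳ 1ᶜ)
    null-suc : ∀ {u} → IsNull (u ∘ suc) → IsNull u
    null-suc (null u→0) = null λ ε 0<ε → let (N , p) = u→0 ε 0<ε in
      suc N , λ { (suc n) (s≤s N≤n) → p n N≤n }
    tail→ : ∀ {u L} → (∀ n → u (suc n) ≈ᶜ L) → u ⇢ L
    tail→ {u} {L} eq with ⇢-resp-≈ (λ n → ℂ.sym (eq n)) ℂ.refl (⇢-const L)
    ... | p ∧ q = null-suc p ∧ null-suc q

  conj-+ : ∀ z w → conj (z +ᶜ w) ≈ᶜ conj z +ᶜ conj w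
  conj-+ (x , y) (u , v) = ≈-refl , solve 2 (λ y v → :- (y :+ v) := (:- y) :+ (:- v)) ≈-refl y v

  conj-* : ∀ z w → conj (z *ᶜ w) ≈ᶜ conj z *ᶜ conj w
  conj-* (x , y) (u , v) =
    solve 4 (λ x y u v → x :* u :- y :* v := x :* u :- (:- y) :* (:- v)) ≈-refl x y u v ,
    solve 4 (λ x y u v → :- (x :* v :+ y :* u) := x :* (:- v) :+ (:- y) :* u) ≈-refl x y u v

  conj-fromℝ : ∀ x → conj (fromℝ x) ≈ᶜ fromℝ x
  conj-fromℝ x = ≈-refl , solve 0 (:- :0 := :0) ≈-refl

  conj-^ : ∀ z n → conj (z ^ᶜ n) ≈ᶜ conj z ^ᶜ n
  conj-^ z zero    = conj-fromℝ 1#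
  conj-^ z (suc n) = ℂ.trans (conj-* z (z ^ᶜ n)) (ℂ.*-congˡ {conj z} (conj-^ z n))

  conj-partialSum : ∀ {a b} → (∀ n → conj (a n) ≈ᶜ b n) →
    ∀ n → conj (Sℂ.partialSum a n) ≈ᶜ Sℂ.partialSum b n
  conj-partialSum conj-a≈b zero    = conj-fromℝ 0#
  conj-partialSum {a} conj-a≈b (suc n) = ℂ.trans
    (conj-+ (a 0) (Sℂ.partialSum (a ∘ suc) n)) (ℂ.+-cong (conj-a≈b 0) (conj-partialSum (conj-a≈b ∘ suc) n))

  -- Conjugation is a continuous ring homomorphism that fixes the real coefficients 1/n!.
  exp-conj : ∀ z → exp (conj z) ≈ᶜ conj (exp z)
  exp-conj z = exp-unique (⇢-resp-≈ (conj-partialSum conj-term) ℂ.refl (⇢-conj (⇢-exp z)))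
    where
    conj-term : ∀ n → conj (Eℂ.term z n) ≈ᶜ Eℂ.term (conj z) n
    conj-term n = ℂ.trans (conj-* (z ^ᶜ n) (fromℝ 1/ n !ℝ)) (ℂ.*-cong (conj-^ z n) (conj-fromℝ 1/ n !ℝ))

  cis : ℝ → ℂ
  cis θ = exp (i· θ)

  cis-cong : ∀ {θ φ} → θ ≈ φ → cis θ ≈ᶜ cis φ
  cis-cong θ≈φ = exp-cong (≈-refl , θ≈φ)

  cis-+ : ∀ θ φ → cis (θ + φ) ≈ᶜ cis θ *ᶜ cis φ
  cis-+ θ φ = ℂ.trans (exp-cong (≈-sym (+-identityˡ 0#) , ≈-refl)) (exp-+ (i· θ) (i· φ))

  cis-0 : cis 0# ≈ᶜ 1ᶜ
  cis-0 = exp-0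

  -- The real part of exp(iθ) times its conjugate exp(-iθ), a product equal to exp 0.
  cos²+sin²≈1 : ∀ θ → Re (cis θ) * Re (cis θ) + Im (cis θ) * Im (cis θ) ≈ 1#
  cos²+sin²≈1 θ = ≈-trans
    (solve 2 (λ c s → c :* c :+ s :* s := c :* c :- s :* (:- s)) ≈-refl (Re (cis θ)) (Im (cis θ)))
    (proj₁ (ℂ.trans (ℂ.*-congˡ {cis θ} (ℂ.sym (exp-conj (i· θ))))
      (ℂ.trans (ℂ.sym (exp-+ (i· θ) (conj (i· θ))))
        (ℂ.trans (exp-cong (+-identityˡ 0# , -‿inverseʳ θ)) exp-0))))

  -- cis 2φ = 1 says c² - s² = 1 and 2cs = 0; as s is nonzero, c = 0 and -s² = 1.
  cis-double≉1 : ∀ φ → ¬ (Im (cis φ) ≈ 0#) → ¬ (cis (φ + φ) ≈ᶜ 1ᶜ)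
  cis-double≉1 φ s≉0 cis2φ≈1 = 0≤-square s (0<-⇒< (<-respʳ-≈ 1≈0-s² 0<1))
    where
    C = Re (cis φ)
    s = Im (cis φ)
    square≈1 : cis φ *ᶜ cis φ ≈ᶜ 1ᶜ
    square≈1 = ℂ.trans (ℂ.sym (cis-+ φ φ)) cis2φ≈1
    C[s+s]≈0 : C * (s + s) ≈ 0#
    C[s+s]≈0 = ≈-trans (solve 2 (λ c s → c :* (s :+ s) := c :* s :+ s :* c) ≈-refl C s) (proj₂ square≈1)
    2s≈0⇒s≈0 : s + s ≈ 0# → s ≈ 0#
    2s≈0⇒s≈0 2s≈0 = ¬#⇒≈ λ s#0 → [ (λ s<0 → <-irrefl (≈-sym -s-s≈0) (+-pos (<0⇒0<- s<0) (<0⇒0<- s<0)))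
                                  , (λ 0<s → <-irrefl (≈-sym 2s≈0) (+-pos 0<s 0<s)) ]′ (#⇒<⊎> s#0)
      where
      -s-s≈0 : - s + - s ≈ 0#
      -s-s≈0 = ≈-trans (solve 1 (λ s → (:- s) :+ (:- s) := :- (s :+ s)) ≈-refl s)
        (≈-trans (-‿cong 2s≈0) (solve 0 (:- :0 := :0) ≈-refl))
    C≈0 : C ≈ 0#
    C≈0 = ¬#⇒≈ λ C#0 → s≉0 (2s≈0⇒s≈0 (*≈0∧#0⇒≈0 C[s+s]≈0 C#0))
    1≈0-s² : 1# ≈ 0# - s * s
    1≈0-s² = ≈-trans (≈-sym (proj₁ square≈1))
      (+-congʳ (≈-trans (*-congˡ C≈0) (zeroʳ C)))

-- Roots of unity

module RootsOfUnity {c ℓ₁ ℓ₂} (R : RealNumbers c ℓ₁ ℓ₂)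
  (exp : Complex.ℂ R → Complex.ℂ R) (isExp : Complex.IsExp R exp)
  (π : RealNumbers.Carrier R) (isPi : Complex.IsPi R exp π) where
  open RealNumbers R renaming (Carrier to ℝ; zero to *-zero)
  open ComplexProperties R
  open ExponentialProperties R
  open ComplexExponential R exp isExp
  open IntegerSolver commutativeRing
  open IsPi isPi

  -- Squaring `cis π` avoids finding the sign of cos π: as sin π = 0, only cos² π = 1 enters.
  cis-2π≈1 : cis (π + π) ≈ᶜ 1ᶜ
  cis-2π≈1 = ℂ.trans (cis-+ π π)
    (≈-trans (solve 2 (λ c s → c :* c :- s :* s := (c :* c :+ s :* s) :- (s :+ s) :* s) ≈-refl C S)
      (≈-trans (+-cong (cos²+sin²≈1 π) (-‿cong (*-congˡ sin-π)))
        (solve 2 (λ o s → o :- s :* :0 := o) ≈-refl 1# (S + S))) ,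
     ≈-trans (+-cong (*-congˡ sin-π) (*-congʳ sin-π))
       (solve 1 (λ c → c :* :0 :+ :0 :* c := :0) ≈-refl C))
    where
    C = Re (cis π)
    S = Im (cis π)

  -- The power exp(2πi n/s), with a natural exponent that is not reduced modulo `s`. The argument is
  -- written as in `χ`, so each factor of `χ` is a `ζ` by computation.
  ζ : (s : ℕ) .{{_ : NonZero s}} → ℕ → ℂ
  ζ s n = cis (fromℕ 2 * π * (fromℕ n * 1/ s))

  module _ (s : ℕ) .{{_ : NonZero s}} where

    ζ-+ : ∀ m n → ζ s (m ℕ.+ n) ≈ᶜ ζ s m *ᶜ ζ s n
    ζ-+ m n = ℂ.trans
      (cis-cong (≈-trans (*-congˡ (*-congʳ (fromℕ-+ m n)))
        (solve 4 (λ t m n i → t :* ((m :+ n) :* i) := t :* (m :* i) :+ t :* (n :* i)) ≈-refl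
          (fromℕ 2 * π) (fromℕ m) (fromℕ n) (1/ s))))
      (cis-+ _ _)

    ζ-0 : ζ s 0 ≈ᶜ 1ᶜ
    ζ-0 = ℂ.trans
      (cis-cong (solve 2 (λ t i → t :* (:0 :* i) := :0) ≈-refl (fromℕ 2 * π) (1/ s))) cis-0

    private
      double : ∀ x → fromℕ 2 * π * x ≈ π * x + π * x
      double x = solve 2 (λ p x → (:1 :+ (:1 :+ :0)) :* p :* x := p :* x :+ p :* x) ≈-refl π x

    ζ-period : ζ s s ≈ᶜ 1ᶜ
    ζ-period = ℂ.trans (cis-cong (≈-trans (*-congˡ (*-inverse-fromℕ s))
      (≈-trans (double 1#) (+-cong (*-identityʳ π) (*-identityʳ π))))) cis-2π≈1

    -- The half angle πn/s lies strictly between 0 and π, where `π-least` excludes a zero of the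
    -- sine.
    ζ-primitive : ∀ n → 0 ℕ.< n → n ℕ.< s → ¬ (ζ s n ≈ᶜ 1ᶜ)
    ζ-primitive n 0<n n<s ζn≈1 = cis-double≉1 (π * (fromℕ n * 1/ s))
      (π-least _ (*-pos π-pos (*-pos (fromℕ-mono-< 0<n) (0<1/ s))) (0<-⇒< (<-respʳ-≈ eq
        (*-pos π-pos (*-pos (<⇒0<- (fromℕ-mono-< n<s)) (0<1/ s))))))
      (ℂ.trans (cis-cong (≈-sym (double _))) ζn≈1)
      where
      eq : π * ((fromℕ s - fromℕ n) * 1/ s) ≈ π - π * (fromℕ n * 1/ s)
      eq = ≈-trans
        (solve 4 (λ p s n i → p :* ((s :- n) :* i) := p :* (s :* i) :- p :* (n :* i)) ≈-refl
          π (fromℕ s) (fromℕ n) (1/ s))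
        (+-congʳ (≈-trans (*-congˡ (*-inverse-fromℕ s)) (*-identityʳ π)))

-- Subsets, cyclic shifts and multiplicities

extend-subset : ∀ {k} (p : Subset k) t → ∣ p ∣ ℕ.≤ t → t ℕ.≤ k →
  ∃[ q ] (p ⊆ q × ∣ q ∣ ≡ t)
extend-subset []            zero    _         _         = [] , (λ x → x) , ≡.refl
extend-subset (inside ∷ p)  (suc t) (s≤s p≤t) (s≤s t≤k) with extend-subset p t p≤t t≤k
... | q , p⊆q , ∣q∣≡t = inside ∷ q , s⊆s p⊆q , ≡.cong suc ∣q∣≡t
extend-subset {suc k} (outside ∷ p) t p≤t t≤1+k with t ℕ.≤? k
... | yes t≤k with extend-subset p t p≤t t≤k
...   | q , p⊆q , ∣q∣≡t = outside ∷ q , out⊆ p⊆q , ∣q∣≡t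
extend-subset {suc k} (outside ∷ p) t p≤t t≤1+k | no t≰k =
  -- Here t exceeds k but not k + 1, so the full set is the only candidate.
  ⊤ , ⊆⊤ , ≡.trans (∣⊤∣≡n (suc k)) (ℕ.≤-antisym (ℕ.≰⇒> t≰k) t≤1+k)

-- Subtraction of 1 in ℤ_n on representatives, where 0 wraps round to n - 1; `cyclicSuc` adds 1.
cyclicPred : ∀ {n} → Fin n → Fin n
cyclicPred {suc n} zero    = Fin.fromℕ n
cyclicPred {suc n} (suc i) = inject₁ i

cyclicSuc : ∀ {n} → Fin n → Fin n
cyclicSuc {suc n} i with view i
... | ‵fromℕ     = zero
... | ‵inject₁ j = suc j

cyclicPred-cyclicSuc : ∀ {n} (i : Fin n) → cyclicPred (cyclicSuc i) ≡ i
cyclicPred-cyclicSuc {suc n} i with view i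
... | ‵fromℕ     = ≡.refl
... | ‵inject₁ j = ≡.refl

cyclicPred-injective : ∀ {n} {i j : Fin n} → cyclicPred i ≡ cyclicPred j → i ≡ j
cyclicPred-injective {i = zero}  {zero}  _  = ≡.refl
cyclicPred-injective {i = zero}  {suc j} eq = contradiction eq Fin.fromℕ≢inject₁
cyclicPred-injective {i = suc i} {zero}  eq = contradiction (≡.sym eq) Fin.fromℕ≢inject₁
cyclicPred-injective {i = suc i} {suc j} eq = ≡.cong suc (Fin.inject₁-injective eq)

-- Relates x to its predecessor p in the naturals, as exponents of `ζ` require: either x = p + 1, or
-- x = 0 and p + 1 = n.
toℕ-cyclicPred : ∀ {n} (i : Fin n) →
  (toℕ i ≡ 0 × suc (toℕ (cyclicPred i)) ≡ n) ⊎ toℕ i ≡ suc (toℕ (cyclicPred i))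
toℕ-cyclicPred {suc n} zero    = inj₁ (≡.refl , ≡.cong suc (Fin.toℕ-fromℕ n))
toℕ-cyclicPred {suc n} (suc i) = inj₂ (≡.cong suc (≡.sym (Fin.toℕ-inject₁ i)))

module Arrays {k : ℕ} (s : Fin k → ℕ) where

  ∈supp⇒≢0 : ∀ (m : G s) {j} → j ∈ supp s m → toℕ (m j) ≢ 0
  ∈supp⇒≢0 m {j} j∈supp mj≡0 = contradiction
    (≡.trans (≡.sym ([]=⇒lookup j∈supp)) (≡.trans (lookup∘tabulate _ j)
      (dec-false (¬? (toℕ (m j) ℕ.≟ 0)) (λ mj≢0 → mj≢0 mj≡0))))
    λ ()

  ≢0⇒∈supp : ∀ (m : G s) {j} → toℕ (m j) ≢ 0 → j ∈ supp s m
  ≢0⇒∈supp m {j} mj≢0 = lookup⇒[]= j (supp s m)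
    (≡.trans (lookup∘tabulate _ j) (dec-true (¬? (toℕ (m j) ℕ.≟ 0)) mj≢0))

  nonzero-coordinate : ∀ (m : G s) → ¬ IsZero s m → ∃[ j ] (toℕ (m j) ≢ 0)
  nonzero-coordinate m = Fin.¬∀⟶∃¬ k _ (λ j → toℕ (m j) ℕ.≟ 0)

  module _ (I : Subset k) where

    _matches_ : G s → G[_] s I → Set
    α matches β = Equal s I (proj s I α) β

    multiplicity-accept : ∀ {α β} A → α matches β →
      multiplicity s I β (α ∷ A) ≡ suc (multiplicity s I β A)
    multiplicity-accept {α} {β} A α~β =
      ≡.cong length (List.filter-accept (λ α → equal? s I (proj s I α) β) α~β)

    multiplicity-reject : ∀ {α β} A → ¬ (α matches β) →
      multiplicity s I β (α ∷ A) ≡ multiplicity s I β A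
    multiplicity-reject {α} {β} A α≁β =
      ≡.cong length (List.filter-reject (λ α → equal? s I (proj s I α) β) α≁β)

    multiplicity-++ : ∀ β A B →
      multiplicity s I β (A ++ B) ≡ multiplicity s I β A ℕ.+ multiplicity s I β B
    multiplicity-++ β A B = ≡.trans
      (≡.cong length (List.filter-++ (λ α → equal? s I (proj s I α) β) A B)) (List.length-++ (filter _ A))

    multiplicity-[-] : ∀ {α α′} β → α matches (proj s I α′) →
      multiplicity s I β (α ∷ []) ≡ multiplicity s I β (α′ ∷ [])
    multiplicity-[-] {α} {α′} β α~α′ = decide (equal? s I (proj s I α′) β)
      where
      decide : Dec (α′ matches β) → multiplicity s I β (α ∷ []) ≡ multiplicity s I β (α′ ∷ [])
      decide (yes α′~β) = ≡.trans
        (multiplicity-accept [] (λ j j∈I → ≡.trans (α~α′ j j∈I) (α′~β j j∈I)))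
        (≡.sym (multiplicity-accept [] α′~β))
      decide (no  α′≁β) = ≡.trans
        (multiplicity-reject [] (λ α~β → α′≁β (λ j j∈I → ≡.trans (≡.sym (α~α′ j j∈I)) (α~β j j∈I))))
        (≡.sym (multiplicity-reject [] α′≁β))

    multiplicity-exchange : ∀ {α α′} β B C → α matches (proj s I α′) →
      multiplicity s I β (B ++ α ∷ C) ≡ multiplicity s I β (α′ ∷ []) ℕ.+ multiplicity s I β (B ++ C)
    multiplicity-exchange {α} {α′} β B C α~α′ = begin
      μ (B ++ α ∷ C)               ≡⟨ multiplicity-++ β B (α ∷ C) ⟩
      μ B ℕ.+ μ (α ∷ C)            ≡⟨ ≡.cong (μ B ℕ.+_) (multiplicity-++ β (α ∷ []) C) ⟩
      μ B ℕ.+ (μ (α ∷ []) ℕ.+ μ C) ≡⟨ ℕ.+-assoc (μ B) (μ (α ∷ [])) (μ C) ⟨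
      μ B ℕ.+ μ (α ∷ []) ℕ.+ μ C   ≡⟨ ≡.cong (ℕ._+ μ C) (ℕ.+-comm (μ B) (μ (α ∷ []))) ⟩
      μ (α ∷ []) ℕ.+ μ B ℕ.+ μ C   ≡⟨ ℕ.+-assoc (μ (α ∷ [])) (μ B) (μ C) ⟩
      μ (α ∷ []) ℕ.+ (μ B ℕ.+ μ C) ≡⟨ ≡.cong₂ ℕ._+_ (multiplicity-[-] β α~α′) (≡.sym (multiplicity-++ β B C)) ⟩
      μ (α′ ∷ []) ℕ.+ μ (B ++ C)   ∎
      where
      open ≡.≡-Reasoning
      μ = multiplicity s I β

    -- Finds the row to strike out when two arrays are matched row by row.
    multiplicity-split : ∀ β A → 0 ℕ.< multiplicity s I β A →
      ∃[ B ] ∃[ α ] ∃[ C ] (A ≡ B ++ α ∷ C × α matches β)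
    multiplicity-split β (α ∷ A) 0<mult = decide (equal? s I (proj s I α) β)
      where
      decide : Dec (α matches β) → ∃[ B ] ∃[ γ ] ∃[ C ] (α ∷ A ≡ B ++ γ ∷ C × γ matches β)
      decide (yes α~β) = [] , α , A , ≡.refl , α~β
      decide (no  α≁β) with multiplicity-split β A (≡.subst (0 ℕ.<_) (multiplicity-reject A α≁β) 0<mult)
      ... | B , γ , C , eq , γ~β = α ∷ B , γ , C , ≡.cong (α ∷_) eq , γ~β

    multiplicity-map : ∀ (f : G s → G s) (β β′ : G[_] s I) →
      (∀ α → f α matches β → α matches β′) → (∀ α → α matches β′ → f α matches β) →
      ∀ A → multiplicity s I β (List.map f A) ≡ multiplicity s I β′ A
    multiplicity-map f β β′ to from []      = ≡.refl
    multiplicity-map f β β′ to from (α ∷ A) = decide (equal? s I (proj s I α) β′)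
      where
      decide : Dec (α matches β′) →
        multiplicity s I β (List.map f (α ∷ A)) ≡ multiplicity s I β′ (α ∷ A)
      decide (yes α~β′) = ≡.trans (multiplicity-accept (List.map f A) (from α α~β′))
        (≡.trans (≡.cong suc (multiplicity-map f β β′ to from A)) (≡.sym (multiplicity-accept A α~β′)))
      decide (no  α≁β′) = ≡.trans (multiplicity-reject (List.map f A) (α≁β′ ∘ to α))
        (≡.trans (multiplicity-map f β β′ to from A) (≡.sym (multiplicity-reject A α≁β′)))

  shift : Fin k → G s → G s
  shift j α i with i Fin.≟ j
  ... | yes _ = cyclicPred (α i)
  ... | no  _ = α i

  shift-at : ∀ j α → shift j α j ≡ cyclicPred (α j)
  shift-at j α with j Fin.≟ j
  ... | yes _   = ≡.refl
  ... | no  j≢j = contradiction ≡.refl j≢j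

  shift-away : ∀ j α i → i ≢ j → shift j α i ≡ α i
  shift-away j α i i≢j with i Fin.≟ j
  ... | yes i≡j = contradiction i≡j i≢j
  ... | no  _   = ≡.refl

  -- The inverse of `shift` on G_I: a shifted row lies over β exactly when the row itself lies over
  -- `unshift I j β`.
  unshift : (I : Subset k) → Fin k → G[_] s I → G[_] s I
  unshift I j β i i∈I with i Fin.≟ j
  ... | yes _ = cyclicSuc (β i i∈I)
  ... | no  _ = β i i∈I

  multiplicity-shift : ∀ I j β A →
    multiplicity s I β (List.map (shift j) A) ≡ multiplicity s I (unshift I j β) A
  multiplicity-shift I j β = multiplicity-map I (shift j) β (unshift I j β)
    (λ α eq i i∈I → to α i i∈I (eq i i∈I)) (λ α eq i i∈I → from α i i∈I (eq i i∈I))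
    where
    to : ∀ α i i∈I → shift j α i ≡ β i i∈I → α i ≡ unshift I j β i i∈I
    to α i i∈I eq with i Fin.≟ j
    ... | yes _ = cyclicPred-injective (≡.trans eq (≡.sym (cyclicPred-cyclicSuc (β i i∈I))))
    ... | no  _ = eq
    from : ∀ α i i∈I → α i ≡ unshift I j β i i∈I → shift j α i ≡ β i i∈I
    from α i i∈I eq with i Fin.≟ j
    ... | yes _ = ≡.trans (≡.cong cyclicPred eq) (cyclicPred-cyclicSuc (β i i∈I))
    ... | no  _ = eq

  -- Shifting only permutes the fibres over G_I, and all of them have λ rows.
  IsOA-shift : ∀ {t A I} → IsOA s t A → ∣ I ∣ ≡ t → ∀ j β →
    multiplicity s I β (List.map (shift j) A) ≡ multiplicity s I β A
  IsOA-shift {A = A} {I} oa ∣I∣≡t j β with oa I ∣I∣≡t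
  ... | _ , _ , constant = ≡.trans (multiplicity-shift I j β A)
    (≡.trans (constant (unshift I j β)) (≡.sym (constant β)))

-- Finite sums and products of complex numbers over arrays

module CharacterSums {c ℓ₁ ℓ₂} (R : RealNumbers c ℓ₁ ℓ₂) where
  open RealNumbers R renaming (Carrier to ℝ; zero to *-zero)
  open ComplexProperties R
  open SetoidReasoning ℂ.setoid
  private
    module Σ = SemiringSum ℂ.semiring
    module Π = MonoidSum ℂ.*-commutativeMonoid

  *ᶜ-congʳ : ∀ z {w w′} → w ≈ᶜ w′ → w *ᶜ z ≈ᶜ w′ *ᶜ z
  *ᶜ-congʳ z = ℂ.*-congʳ {z}

  *ᶜ-congˡ : ∀ z {w w′} → w ≈ᶜ w′ → z *ᶜ w ≈ᶜ z *ᶜ w′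
  *ᶜ-congˡ z = ℂ.*-congˡ {z}

  product-1 : ∀ {n} (f : Fin n → ℂ) → (∀ i → f i ≈ᶜ 1ᶜ) → productᶜ f ≈ᶜ 1ᶜ
  product-1 {zero}  f f≈1 = ℂ.refl
  product-1 {suc n} f f≈1 = ℂ.trans (ℂ.*-cong (f≈1 zero) (product-1 (f ∘ suc) (f≈1 ∘ suc))) (ℂ.*-identityˡ 1ᶜ)

  product-scale : ∀ {n} (f g : Fin n → ℂ) u j → f j ≈ᶜ u *ᶜ g j → (∀ i → i ≢ j → f i ≈ᶜ g i) →
    productᶜ f ≈ᶜ u *ᶜ productᶜ g
  product-scale f g u zero    at away = ℂ.trans
    (ℂ.*-cong at (Π.sum-cong-≋ (λ i → away (suc i) λ ())))
    (ℂ.*-assoc u (g zero) (productᶜ (g ∘ suc)))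
  product-scale f g u (suc j) at away = begin
    f zero *ᶜ productᶜ (f ∘ suc)
      ≈⟨ ℂ.*-cong (away zero λ ())
           (product-scale (f ∘ suc) (g ∘ suc) u j at (λ i i≢j → away (suc i) (i≢j ∘ Fin.suc-injective))) ⟩
    g zero *ᶜ (u *ᶜ productᶜ (g ∘ suc))   ≈⟨ ℂ.*-assoc (g zero) u (productᶜ (g ∘ suc)) ⟨
    (g zero *ᶜ u) *ᶜ productᶜ (g ∘ suc)   ≈⟨ *ᶜ-congʳ (productᶜ (g ∘ suc)) (ℂ.*-comm (g zero) u) ⟩
    (u *ᶜ g zero) *ᶜ productᶜ (g ∘ suc)   ≈⟨ ℂ.*-assoc u (g zero) (productᶜ (g ∘ suc)) ⟩
    u *ᶜ (g zero *ᶜ productᶜ (g ∘ suc))   ∎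

  -- The truth value travels with the 0 or 1, so it never has to be read off from a complex number.
  product-indicator : ∀ {n} (f : Fin n → ℂ) (P : Fin n → Set) →
    (∀ j → (P j × f j ≈ᶜ 1ᶜ) ⊎ (¬ P j × f j ≈ᶜ 0ᶜ)) →
    ((∀ j → P j) × productᶜ f ≈ᶜ 1ᶜ) ⊎ (¬ (∀ j → P j) × productᶜ f ≈ᶜ 0ᶜ)
  product-indicator {zero}  f P indicator = inj₁ ((λ ()) , ℂ.refl)
  product-indicator {suc n} f P indicator =
    combine (indicator zero) (product-indicator (f ∘ suc) (P ∘ suc) (indicator ∘ suc))
    where
    combine : _ → _ → _
    combine (inj₁ (p , f≈1)) (inj₁ (ps , fs≈1)) =
      inj₁ (Fin.∀-cons p ps , ℂ.trans (ℂ.*-cong f≈1 fs≈1) (ℂ.*-identityˡ 1ᶜ))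
    combine (inj₁ _) (inj₂ (¬ps , fs≈0)) =
      inj₂ ((λ ps → ¬ps (ps ∘ suc)) , ℂ.trans (*ᶜ-congˡ (f zero) fs≈0) (ℂ.zeroʳ (f zero)))
    combine (inj₂ (¬p , f≈0)) _ =
      inj₂ ((λ ps → ¬p (ps zero)) , ℂ.trans (*ᶜ-congʳ (productᶜ (f ∘ suc)) f≈0) (ℂ.zeroˡ (productᶜ (f ∘ suc))))

  module _ {X : Set} where

    sumOver-cong : ∀ (xs : List X) {f g} → (∀ x → f x ≈ᶜ g x) → sumOver xs f ≈ᶜ sumOver xs g
    sumOver-cong []       f≈g = ℂ.refl
    sumOver-cong (x ∷ xs) f≈g = ℂ.+-cong (f≈g x) (sumOver-cong xs f≈g)

    sumOver-*ˡ : ∀ z (xs : List X) f → sumOver xs (λ x → z *ᶜ f x) ≈ᶜ z *ᶜ sumOver xs f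
    sumOver-*ˡ z []       f = ℂ.sym (ℂ.zeroʳ z)
    sumOver-*ˡ z (x ∷ xs) f = ℂ.trans (ℂ.+-congˡ {z *ᶜ f x} (sumOver-*ˡ z xs f))
      (ℂ.sym (ℂ.distribˡ z (f x) (sumOver xs f)))

    sumOver-sum : ∀ (xs : List X) {n} (f : Fin n → X → ℂ) →
      sumOver xs (λ x → sumᶜ (λ i → f i x)) ≈ᶜ sumᶜ (λ i → sumOver xs (f i))
    sumOver-sum []       {n} f = ℂ.sym (Σ.sum-replicate-zero n)
    sumOver-sum (x ∷ xs) f = ℂ.trans (ℂ.+-congˡ {sumᶜ (λ i → f i x)} (sumOver-sum xs f))
      (ℂ.sym (Σ.∑-distrib-+ (λ i → f i x) (λ i → sumOver xs (f i))))

    sumOver-map : ∀ (xs : List X) (g : X → X) (f : X → ℂ) → sumOver (List.map g xs) f ≡ sumOver xs (f ∘ g)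
    sumOver-map xs g f = ≡.cong (List.foldr _+ᶜ_ 0ᶜ) (≡.sym (List.map-∘ xs))

    sumOver-insert : ∀ f (xs : List X) y ys → sumOver (xs ++ y ∷ ys) f ≈ᶜ f y +ᶜ sumOver (xs ++ ys) f
    sumOver-insert f []       y ys = ℂ.refl
    sumOver-insert f (x ∷ xs) y ys = begin
      f x +ᶜ sumOver (xs ++ y ∷ ys) f            ≈⟨ ℂ.+-congˡ {f x} (sumOver-insert f xs y ys) ⟩
      f x +ᶜ (f y +ᶜ sumOver (xs ++ ys) f)       ≈⟨ ℂ.+-assoc (f x) (f y) (sumOver (xs ++ ys) f) ⟨
      (f x +ᶜ f y) +ᶜ sumOver (xs ++ ys) f       ≈⟨ ℂ.+-congʳ {sumOver (xs ++ ys) f} (ℂ.+-comm (f x) (f y)) ⟩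
      (f y +ᶜ f x) +ᶜ sumOver (xs ++ ys) f       ≈⟨ ℂ.+-assoc (f y) (f x) (sumOver (xs ++ ys) f) ⟩
      f y +ᶜ (f x +ᶜ sumOver (xs ++ ys) f)       ∎

    -- Both sides are multilinear, so it suffices to compare the terms of the expanded products.
    sumOver-multilinear : ∀ (xs : List X) {k} (n : Fin k → ℕ) (a b : ∀ j → Fin (n j) → X → ℂ) (w v : X → ℂ) →
      (∀ (m : ∀ j → Fin (n j)) →
        sumOver xs (λ x → w x *ᶜ productᶜ (λ j → a j (m j) x)) ≈ᶜ
        sumOver xs (λ x → v x *ᶜ productᶜ (λ j → b j (m j) x))) →
      sumOver xs (λ x → w x *ᶜ productᶜ (λ j → sumᶜ (λ i → a j i x))) ≈ᶜ
      sumOver xs (λ x → v x *ᶜ productᶜ (λ j → sumᶜ (λ i → b j i x)))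
    sumOver-multilinear xs {zero}  n a b w v eq = eq λ ()
    sumOver-multilinear xs {suc k} n a b w v eq = ℂ.trans (expand a w) (ℂ.trans
      (Σ.sum-cong-≋ λ i → sumOver-multilinear xs (n ∘ suc) (a ∘ suc) (b ∘ suc)
        -- The chosen term of the first factor moves into the weight; this is why the statement
        -- carries `w` and `v`.
        (λ x → w x *ᶜ a zero i x) (λ x → v x *ᶜ b zero i x)
        λ m → ℂ.trans (regroup a w i m) (ℂ.trans (eq (Fin.∀-cons i m)) (ℂ.sym (regroup b v i m))))
      (ℂ.sym (expand b v)))
      where
      regroup : ∀ (a : ∀ j → Fin (n j) → X → ℂ) w i (m : ∀ j → Fin (n (suc j))) →
        sumOver xs (λ x → (w x *ᶜ a zero i x) *ᶜ productᶜ (λ j → a (suc j) (m j) x)) ≈ᶜ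
        sumOver xs (λ x → w x *ᶜ (a zero i x *ᶜ productᶜ (λ j → a (suc j) (m j) x)))
      regroup a w i m = sumOver-cong xs λ x →
        ℂ.*-assoc (w x) (a zero i x) (productᶜ (λ j → a (suc j) (m j) x))
      expand : ∀ (a : ∀ j → Fin (n j) → X → ℂ) w →
        sumOver xs (λ x → w x *ᶜ productᶜ (λ j → sumᶜ (λ i → a j i x))) ≈ᶜ
        sumᶜ (λ i → sumOver xs (λ x → (w x *ᶜ a zero i x) *ᶜ productᶜ (λ j → sumᶜ (λ i → a (suc j) i x))))
      expand a w = ℂ.trans
        (sumOver-cong xs λ x → let P = productᶜ (λ j → sumᶜ (λ i → a (suc j) i x)) in begin
          w x *ᶜ (sumᶜ (λ i → a zero i x) *ᶜ P)   ≈⟨ ℂ.*-assoc (w x) (sumᶜ (λ i → a zero i x)) P ⟨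
          (w x *ᶜ sumᶜ (λ i → a zero i x)) *ᶜ P   ≈⟨ *ᶜ-congʳ P (Σ.*-distribˡ-sum (w x) (λ i → a zero i x)) ⟩
          sumᶜ (λ i → w x *ᶜ a zero i x) *ᶜ P     ≈⟨ Σ.*-distribʳ-sum P (λ i → w x *ᶜ a zero i x) ⟩
          sumᶜ (λ i → (w x *ᶜ a zero i x) *ᶜ P)   ∎)
        (sumOver-sum xs λ i x → (w x *ᶜ a zero i x) *ᶜ productᶜ (λ j → sumᶜ (λ i → a (suc j) i x)))

  module _ {k} (s : Fin k → ℕ) (I : Subset k) where
    open Arrays s

    -- Arrays with equal multiplicities on G_I are permutations of each other up to coordinates
    -- outside I. Each row of `A` is paired with a matching row of `B`, and removing both keeps the
    -- multiplicities equal.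
    sumOver-multiplicity : ∀ f → (∀ α α′ → _matches_ I α (proj s I α′) → f α ≈ᶜ f α′) →
      ∀ A B → (∀ β → multiplicity s I β A ≡ multiplicity s I β B) → sumOver A f ≈ᶜ sumOver B f
    sumOver-multiplicity f f-resp []      []      _  = ℂ.refl
    sumOver-multiplicity f f-resp []      (α ∷ B) eq = contradiction
      (≡.trans (eq (proj s I α)) (multiplicity-accept I B (λ _ _ → ≡.refl))) λ ()
    sumOver-multiplicity f f-resp (α ∷ A) B       eq
      with multiplicity-split I (proj s I α) B
        (≡.subst (0 ℕ.<_) (≡.trans (≡.sym (multiplicity-accept I A (λ _ _ → ≡.refl))) (eq (proj s I α))) (s≤s z≤n))
    ... | C , γ , D , ≡.refl , γ~α = begin
      f α +ᶜ sumOver A f          ≈⟨ ℂ.+-cong (f-resp α γ λ j j∈I → ≡.sym (γ~α j j∈I))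
                                       (sumOver-multiplicity f f-resp A (C ++ D) eq′) ⟩
      f γ +ᶜ sumOver (C ++ D) f   ≈⟨ sumOver-insert f C γ D ⟨
      sumOver (C ++ γ ∷ D) f      ∎
      where
      eq′ : ∀ β → multiplicity s I β A ≡ multiplicity s I β (C ++ D)
      eq′ β = ℕ.+-cancelˡ-≡ (multiplicity s I β (α ∷ [])) _ _ (≡.trans
        (≡.sym (multiplicity-++ I β (α ∷ []) A)) (≡.trans (eq β) (multiplicity-exchange I β C D γ~α)))

    sumOver-indicator : ∀ β (f : G s → ℂ) →
      (∀ α → (_matches_ I α β × f α ≈ᶜ 1ᶜ) ⊎ (¬ (_matches_ I α β) × f α ≈ᶜ 0ᶜ)) →
      ∀ A → sumOver A f ≈ᶜ fromℝ (fromℕ (multiplicity s I β A))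
    sumOver-indicator β f indicator []      = ℂ.refl
    sumOver-indicator β f indicator (α ∷ A) = combine (indicator α)
      where
      n = multiplicity s I β A
      combine : (_matches_ I α β × f α ≈ᶜ 1ᶜ) ⊎ (¬ (_matches_ I α β) × f α ≈ᶜ 0ᶜ) →
        f α +ᶜ sumOver A f ≈ᶜ fromℝ (fromℕ (multiplicity s I β (α ∷ A)))
      combine (inj₁ (α~β , fα≈1)) = begin
        f α +ᶜ sumOver A f           ≈⟨ ℂ.+-cong fα≈1 (sumOver-indicator β f indicator A) ⟩
        1ᶜ +ᶜ fromℝ (fromℕ n)        ≈⟨ fromℝ-+ 1# (fromℕ n) ⟨
        fromℝ (fromℕ (suc n))        ≡⟨ ≡.cong (fromℝ ∘ fromℕ) (multiplicity-accept I A α~β) ⟨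
        fromℝ (fromℕ (multiplicity s I β (α ∷ A))) ∎
      combine (inj₂ (α≁β , fα≈0)) = begin
        f α +ᶜ sumOver A f           ≈⟨ ℂ.+-cong fα≈0 (sumOver-indicator β f indicator A) ⟩
        0ᶜ +ᶜ fromℝ (fromℕ n)        ≈⟨ ℂ.+-identityˡ (fromℝ (fromℕ n)) ⟩
        fromℝ (fromℕ n)              ≡⟨ ≡.cong (fromℝ ∘ fromℕ) (multiplicity-reject I A α≁β) ⟨
        fromℝ (fromℕ (multiplicity s I β (α ∷ A))) ∎

-- Characters and the two directions of the equivalence

module CharacterTheory {c ℓ₁ ℓ₂} (R : RealNumbers c ℓ₁ ℓ₂)
  (exp : Complex.ℂ R → Complex.ℂ R) (isExp : Complex.IsExp R exp)
  (π : RealNumbers.Carrier R) (isPi : Complex.IsPi R exp π) where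
  open RealNumbers R renaming (Carrier to ℝ; zero to *-zero)
  open ComplexProperties R
  open ExponentialProperties R using (fromℝ-cong; fromℝ-fromℕ; module Sℂ)
  open CharacterSums R
  open RootsOfUnity R exp isExp π isPi
  open Characters R
  open SemiringExp ℂ.semiring using (^-congˡ)
  open RingProperties ℂ.ring using (x∙y⁻¹≈ε⇒x≈y)
  open SetoidReasoning ℂ.setoid
  private
    module Σ = SemiringSum ℂ.semiring
    module Π = MonoidSum ℂ.*-commutativeMonoid

  ≉1∧*≈⇒≈0 : ∀ {u z} → ¬ (u ≈ᶜ 1ᶜ) → u *ᶜ z ≈ᶜ z → z ≈ᶜ 0ᶜ
  ≉1∧*≈⇒≈0 {u} {z} u≉1 uz≈z = *ᶜ-cancel-≉0 (u ℂ.- 1ᶜ) z (begin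
    (u ℂ.- 1ᶜ) *ᶜ z            ≈⟨ RingProperties.[y-z]x≈yx-zx ℂ.ring z u 1ᶜ ⟩
    u *ᶜ z ℂ.- 1ᶜ *ᶜ z         ≈⟨ ℂ.+-cong uz≈z (ℂ.-‿cong (ℂ.*-identityˡ z)) ⟩
    z ℂ.- z                    ≈⟨ ℂ.-‿inverseʳ z ⟩
    0ᶜ                         ∎)
    (λ u-1≈0 → u≉1 (x∙y⁻¹≈ε⇒x≈y u 1ᶜ u-1≈0))

  1^n≈1 : ∀ n → 1ᶜ ^ᶜ n ≈ᶜ 1ᶜ
  1^n≈1 zero    = ℂ.refl
  1^n≈1 (suc n) = ℂ.trans (ℂ.*-identityˡ (1ᶜ ^ᶜ n)) (1^n≈1 n)

  module _ (s : ℕ) .{{_ : NonZero s}} where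

    ζ-* : ∀ m n → ζ s (m ℕ.* n) ≈ᶜ ζ s n ^ᶜ m
    ζ-* zero    n = ζ-0 s
    ζ-* (suc m) n = ℂ.trans (ζ-+ s n (m ℕ.* n)) (*ᶜ-congˡ (ζ s n) (ζ-* m n))

    ζ-multiple : ∀ m → ζ s (m ℕ.* s) ≈ᶜ 1ᶜ
    ζ-multiple m = ℂ.trans (ζ-* m s) (ℂ.trans (^-congˡ m (ζ-period s)) (1^n≈1 m))

    ζ^s≈1 : ∀ n → ζ s n ^ᶜ s ≈ᶜ 1ᶜ
    ζ^s≈1 n = ℂ.trans (ℂ.sym (ζ-* s n)) (ℂ.trans (ℂ.reflexive (≡.cong (ζ s) (ℕ.*-comm s n))) (ζ-multiple n))

    -- The natural number s - b stands for -b. For x < b the exponent already lies strictly between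
    -- 0 and s; for x > b it exceeds s, and one period is removed.
    ζ-difference≉1 : ∀ (x b : Fin s) → x ≢ b → ¬ (ζ s (toℕ x ℕ.+ (s ℕ.∸ toℕ b)) ≈ᶜ 1ᶜ)
    ζ-difference≉1 x b x≢b = decide (ℕ.<-cmp (toℕ x) (toℕ b))
      where
      decide : Tri (toℕ x ℕ.< toℕ b) (toℕ x ≡ toℕ b) (toℕ b ℕ.< toℕ x) →
        ¬ (ζ s (toℕ x ℕ.+ (s ℕ.∸ toℕ b)) ≈ᶜ 1ᶜ)
      decide (tri≈ _ x≡b _) _ = x≢b (Fin.toℕ-injective x≡b)
      decide (tri< x<b _ _) = ζ-primitive s _
        (ℕ.<-≤-trans (ℕ.m<n⇒0<n∸m (Fin.toℕ<n b)) (ℕ.m≤n+m _ (toℕ x)))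
        (≡.subst (toℕ x ℕ.+ (s ℕ.∸ toℕ b) ℕ.<_) (ℕ.m+[n∸m]≡n (ℕ.<⇒≤ (Fin.toℕ<n b)))
          (ℕ.+-monoˡ-< (s ℕ.∸ toℕ b) x<b))
      decide (tri> _ _ b<x) ≈1 = ζ-primitive s (toℕ x ℕ.∸ toℕ b)
        (ℕ.m<n⇒0<n∸m b<x) (ℕ.≤-<-trans (ℕ.m∸n≤m (toℕ x) (toℕ b)) (Fin.toℕ<n x)) (begin
        ζ s (toℕ x ℕ.∸ toℕ b)                       ≈⟨ ℂ.*-identityʳ _ ⟨
        ζ s (toℕ x ℕ.∸ toℕ b) *ᶜ 1ᶜ                 ≈⟨ *ᶜ-congˡ (ζ s (toℕ x ℕ.∸ toℕ b)) (ζ-period s) ⟨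
        ζ s (toℕ x ℕ.∸ toℕ b) *ᶜ ζ s s              ≈⟨ ζ-+ s (toℕ x ℕ.∸ toℕ b) s ⟨
        ζ s (toℕ x ℕ.∸ toℕ b ℕ.+ s)                 ≡⟨ ≡.cong (ζ s) rearrange ⟩
        ζ s (toℕ x ℕ.+ (s ℕ.∸ toℕ b))               ≈⟨ ≈1 ⟩
        1ᶜ                                          ∎)
        where
        rearrange : toℕ x ℕ.∸ toℕ b ℕ.+ s ≡ toℕ x ℕ.+ (s ℕ.∸ toℕ b)
        rearrange = ≡.trans (≡.sym (ℕ.+-∸-comm s (ℕ.<⇒≤ b<x)))
          (ℕ.+-∸-assoc (toℕ x) (ℕ.<⇒≤ (Fin.toℕ<n b)))

    -- The indicator function of b in ℤ_s is (1/s) ∑ᵢ ζ^{ix} ζ^{-ib}.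
    indicatorMode : ∀ (b i x : Fin s) → ℂ
    indicatorMode b i x = ζ s (toℕ i ℕ.* toℕ x) *ᶜ ζ s (toℕ i ℕ.* (s ℕ.∸ toℕ b))

    private
      sum-indicatorMode : ∀ b x →
        sumᶜ (λ i → indicatorMode b i x) ≈ᶜ Sℂ.partialSum (ζ s (toℕ x ℕ.+ (s ℕ.∸ toℕ b)) ^ᶜ_) s
      sum-indicatorMode b x = Σ.sum-cong-≋ {s} λ i → ℂ.trans
        (ℂ.sym (ζ-+ s (toℕ i ℕ.* toℕ x) (toℕ i ℕ.* (s ℕ.∸ toℕ b))))
        (ℂ.trans (ℂ.reflexive (≡.cong (ζ s) (≡.sym (ℕ.*-distribˡ-+ (toℕ i) (toℕ x) (s ℕ.∸ toℕ b)))))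
          (ζ-* (toℕ i) (toℕ x ℕ.+ (s ℕ.∸ toℕ b))))

    sum-indicatorMode-≡ : ∀ b → sumᶜ (λ i → indicatorMode b i b) ≈ᶜ fromℝ (fromℕ s)
    sum-indicatorMode-≡ b = begin
      sumᶜ (λ i → indicatorMode b i b)                       ≈⟨ sum-indicatorMode b b ⟩
      Sℂ.partialSum (v ^ᶜ_) s
        ≈⟨ Σ.sum-cong-≋ {s} (λ i → ℂ.trans (^-congˡ (toℕ i) v≈1) (1^n≈1 (toℕ i))) ⟩
      sumᶜ {s} (λ _ → 1ᶜ)                                    ≈⟨ Σ.sum-replicate s ⟩
      _                                                      ≈⟨ fromℝ-fromℕ s ⟩
      fromℝ (fromℕ s)                                        ∎
      where
      v = ζ s (toℕ b ℕ.+ (s ℕ.∸ toℕ b))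
      v≈1 : v ≈ᶜ 1ᶜ
      v≈1 = ℂ.trans (ℂ.reflexive (≡.cong (ζ s) (ℕ.m+[n∸m]≡n (ℕ.<⇒≤ (Fin.toℕ<n b))))) (ζ-period s)

    -- The modes form a geometric sum with ratio v = ζ^(x-b), and v^s = 1 while v ≠ 1.
    sum-indicatorMode-≢ : ∀ b x → x ≢ b → sumᶜ (λ i → indicatorMode b i x) ≈ᶜ 0ᶜ
    sum-indicatorMode-≢ b x x≢b = ℂ.trans (sum-indicatorMode b x)
      (*ᶜ-cancel-≉0 (v ℂ.- 1ᶜ) (Sℂ.partialSum (v ^ᶜ_) s)
        (begin
          (v ℂ.- 1ᶜ) *ᶜ Sℂ.partialSum (v ^ᶜ_) s   ≈⟨ Sℂ.geometric v s ⟩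
          v ^ᶜ s ℂ.- 1ᶜ                            ≈⟨ ℂ.+-congʳ {ℂ.- 1ᶜ} (ζ^s≈1 (toℕ x ℕ.+ (s ℕ.∸ toℕ b))) ⟩
          1ᶜ ℂ.- 1ᶜ                                ≈⟨ ℂ.-‿inverseʳ 1ᶜ ⟩
          0ᶜ                                       ∎)
        (λ v-1≈0 → ζ-difference≉1 x b x≢b (x∙y⁻¹≈ε⇒x≈y v 1ᶜ v-1≈0)))
      where v = ζ s (toℕ x ℕ.+ (s ℕ.∸ toℕ b))

    ζ-cyclicPred : ∀ m (x : Fin s) → ζ s (m ℕ.* toℕ x) ≈ᶜ ζ s m *ᶜ ζ s (m ℕ.* toℕ (cyclicPred x))
    ζ-cyclicPred m x = ℂ.trans (reduce m x) (ζ-+ s m (m ℕ.* toℕ (cyclicPred x)))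
      where
      reduce : ∀ m (x : Fin s) → ζ s (m ℕ.* toℕ x) ≈ᶜ ζ s (m ℕ.+ m ℕ.* toℕ (cyclicPred x))
      reduce m x with toℕ-cyclicPred x
      -- At the wrap the exponents 0 and m(p + 1) = ms differ by m full periods.
      ... | inj₁ (x≡0 , 1+p≡s) = begin
        ζ s (m ℕ.* toℕ x)                            ≡⟨ ≡.cong (λ y → ζ s (m ℕ.* y)) x≡0 ⟩
        ζ s (m ℕ.* 0)                                ≡⟨ ≡.cong (ζ s) (ℕ.*-zeroʳ m) ⟩
        ζ s 0                                        ≈⟨ ζ-0 s ⟩
        1ᶜ                                           ≈⟨ ζ-multiple m ⟨
        ζ s (m ℕ.* s)                                ≡⟨ ≡.cong (λ y → ζ s (m ℕ.* y)) 1+p≡s ⟨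
        ζ s (m ℕ.* suc (toℕ (cyclicPred x)))         ≡⟨ ≡.cong (ζ s) (ℕ.*-suc m (toℕ (cyclicPred x))) ⟩
        ζ s (m ℕ.+ m ℕ.* toℕ (cyclicPred x))         ∎
      ... | inj₂ x≡1+p = ℂ.reflexive (≡.cong (ζ s)
        (≡.trans (≡.cong (m ℕ.*_) x≡1+p) (ℕ.*-suc m (toℕ (cyclicPred x)))))

  module _ {k : ℕ} (s : Fin k → ℕ) where
    open Arrays s

    private
      factor : G s → G s → Fin k → ℂ
      factor m x j = ζ (s j) {{Fin.nonZeroIndex (m j)}} (toℕ (m j) ℕ.* toℕ (x j))

    χ-shift : ∀ m x j →
      χ exp π s m x ≈ᶜ ζ (s j) {{Fin.nonZeroIndex (m j)}} (toℕ (m j)) *ᶜ χ exp π s m (shift j x)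
    χ-shift m x j = product-scale (factor m x) (factor m (shift j x)) _ j
      (ℂ.trans (ζ-cyclicPred (s j) {{Fin.nonZeroIndex (m j)}} (toℕ (m j)) (x j))
        (*ᶜ-congˡ _ (ℂ.reflexive (≡.cong
          (λ y → ζ (s j) {{Fin.nonZeroIndex (m j)}} (toℕ (m j) ℕ.* toℕ y)) (≡.sym (shift-at j x))))))
      (λ i i≢j → ℂ.reflexive (≡.cong
        (λ y → ζ (s i) {{Fin.nonZeroIndex (m i)}} (toℕ (m i) ℕ.* toℕ y)) (≡.sym (shift-away j x i i≢j))))

    -- Coordinates outside the support of m enter only with exponent 0, so the character factors
    -- through the projection to G_I.
    χ-cong : ∀ {I} m → supp s m ⊆ I → ∀ α α′ → _matches_ I α (proj s I α′) →
      χ exp π s m α ≈ᶜ χ exp π s m α′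
    χ-cong {I} m supp⊆I α α′ α~α′ = Π.sum-cong-≋ {k} λ j → ℂ.reflexive
      (≡.cong (ζ (s j) {{Fin.nonZeroIndex (m j)}}) (decide j (toℕ (m j) ℕ.≟ 0)))
      where
      decide : ∀ j → Dec (toℕ (m j) ≡ 0) → toℕ (m j) ℕ.* toℕ (α j) ≡ toℕ (m j) ℕ.* toℕ (α′ j)
      decide j (yes mj≡0) = ≡.trans (≡.cong (ℕ._* toℕ (α j)) mj≡0) (≡.sym (≡.cong (ℕ._* toℕ (α′ j)) mj≡0))
      decide j (no  mj≢0) = ≡.cong (λ y → toℕ (m j) ℕ.* toℕ y) (α~α′ j (supp⊆I (≢0⇒∈supp m mj≢0)))

    IsOA⇒character-sum≈0 : ∀ {t A} → t ℕ.≤ k → IsOA s t A →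
      ∀ m → ¬ IsZero s m → ∣ supp s m ∣ ℕ.≤ t → sumOver A (χ exp π s m) ≈ᶜ 0ᶜ
    IsOA⇒character-sum≈0 {t} {A} t≤k oa m m≢0 ∣supp∣≤t
      with nonzero-coordinate m m≢0 | extend-subset (supp s m) t ∣supp∣≤t t≤k
    ... | j , mj≢0 | I , supp⊆I , ∣I∣≡t = ≉1∧*≈⇒≈0
      (ζ-primitive (s j) {{Fin.nonZeroIndex (m j)}} (toℕ (m j)) (ℕ.n≢0⇒n>0 mj≢0) (Fin.toℕ<n (m j)))
      (begin
        u *ᶜ sumOver A X
          -- The array and its shift have the same multiplicities on G_I, and the character depends
          -- only on that projection.
          ≈⟨ *ᶜ-congˡ u (sumOver-multiplicity s I X (χ-cong m supp⊆I) A (List.map (shift j) A)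
               (λ β → ≡.sym (IsOA-shift {t} {A} {I} oa ∣I∣≡t j β))) ⟩
        u *ᶜ sumOver (List.map (shift j) A) X         ≡⟨ ≡.cong (u *ᶜ_) (sumOver-map A (shift j) X) ⟩
        u *ᶜ sumOver A (X ∘ shift j)                  ≈⟨ sumOver-*ˡ u A (X ∘ shift j) ⟨
        sumOver A (λ x → u *ᶜ X (shift j x))          ≈⟨ sumOver-cong A (λ x → χ-shift m x j) ⟨
        sumOver A X                                   ∎)
      where
      X = χ exp π s m
      u = ζ (s j) {{Fin.nonZeroIndex (m j)}} (toℕ (m j))

    module _ (1≤s : ∀ j → 1 ℕ.≤ s j) (I : Subset k) where

      private
        instance
          s-nonZero : ∀ {j} → NonZero (s j)
          s-nonZero {j} = ℕ.>-nonZero (1≤s j)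

        origin : G s
        origin j = fromℕ< (1≤s j)

        -- A coordinate outside I gets one mode, the trivial one. The indicator on G_I thus becomes
        -- a product over all k coordinates, and each choice of modes is an element of G with
        -- support in I.
        modeCount : ∀ j → Dec (j ∈ I) → ℕ
        modeCount j (yes _) = s j
        modeCount j (no  _) = 1

        mode : ∀ j d → Fin (modeCount j d) → Fin (s j)
        mode j (yes _) i = i
        mode j (no  _) _ = origin j

        weight : ∀ j → Dec (j ∈ I) → ℂ
        weight j (yes _) = fromℝ (1/ s j)
        weight j (no  _) = 1ᶜ

        extend : G[_] s I → ∀ j → Dec (j ∈ I) → Fin (s j)
        extend β j (yes j∈I) = β j j∈I
        extend β j (no  _)   = origin j

        summand : G[_] s I → ∀ j d → Fin (modeCount j d) → G s → ℂ
        summand β j d i x = weight j d *ᶜ indicatorMode (s j) (extend β j d) (mode j d i) (x j)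

        -- Quantifying over membership makes the condition vacuous outside I; over all j it is
        -- exactly the statement that x matches β.
        Agree : G[_] s I → G s → Fin k → Set
        Agree β x j = ∀ j∈I → x j ≡ β j j∈I

        -- Inside I this is orthogonality of the characters of ℤ_s normalised by 1/s; outside I a
        -- single term equals 1.
        sum-summand : ∀ β x j d →
          (Agree β x j × sumᶜ (λ i → summand β j d i x) ≈ᶜ 1ᶜ) ⊎
          (¬ Agree β x j × sumᶜ (λ i → summand β j d i x) ≈ᶜ 0ᶜ)
        sum-summand β x j (yes j∈I) = decide (x j Fin.≟ β j j∈I)
          where
          w = fromℝ (1/ s j)
          factor-out : sumᶜ (λ i → summand β j (yes j∈I) i x) ≈ᶜ
            w *ᶜ sumᶜ (λ i → indicatorMode (s j) (β j j∈I) i (x j))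
          factor-out = ℂ.sym (Σ.*-distribˡ-sum w (λ i → indicatorMode (s j) (β j j∈I) i (x j)))
          decide : Dec (x j ≡ β j j∈I) → _
          decide (yes xj≡βj) = inj₁
            ((λ j∈I′ → ≡.subst (λ p → x j ≡ β j p) ([]=-irrelevant j∈I j∈I′) xj≡βj) , (begin
              sumᶜ (λ i → summand β j (yes j∈I) i x)                       ≈⟨ factor-out ⟩
              w *ᶜ sumᶜ (λ i → indicatorMode (s j) (β j j∈I) i (x j))
                ≡⟨ ≡.cong (λ y → w *ᶜ sumᶜ (λ i → indicatorMode (s j) (β j j∈I) i y)) xj≡βj ⟩
              w *ᶜ sumᶜ (λ i → indicatorMode (s j) (β j j∈I) i (β j j∈I))
                ≈⟨ *ᶜ-congˡ w (sum-indicatorMode-≡ (s j) (β j j∈I)) ⟩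
              w *ᶜ fromℝ (fromℕ (s j))                                     ≈⟨ fromℝ-* (1/ s j) (fromℕ (s j)) ⟨
              fromℝ (1/ s j * fromℕ (s j))
                ≈⟨ fromℝ-cong (≈-trans (*-comm _ _) (*-inverse-fromℕ (s j))) ⟩
              1ᶜ                                                           ∎))
          decide (no  xj≢βj) = inj₂
            ((λ agree → xj≢βj (agree j∈I)) , ℂ.trans factor-out
              (ℂ.trans (*ᶜ-congˡ w (sum-indicatorMode-≢ (s j) (β j j∈I) (x j) xj≢βj)) (ℂ.zeroʳ w)))
        sum-summand β x j (no  j∉I) = inj₁ ((λ j∈I → contradiction j∈I j∉I) , (begin
          1ᶜ *ᶜ indicatorMode (s j) (origin j) (origin j) (x j) +ᶜ 0ᶜ
            ≈⟨ ℂ.+-identityʳ (1ᶜ *ᶜ indicatorMode (s j) (origin j) (origin j) (x j)) ⟩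
          1ᶜ *ᶜ indicatorMode (s j) (origin j) (origin j) (x j)
            ≈⟨ ℂ.*-identityˡ (indicatorMode (s j) (origin j) (origin j) (x j)) ⟩
          indicatorMode (s j) (origin j) (origin j) (x j)
            ≈⟨ ℂ.*-cong (trivial (toℕ (x j))) (trivial (s j ℕ.∸ toℕ (origin j))) ⟩
          1ᶜ *ᶜ 1ᶜ   ≈⟨ ℂ.*-identityˡ 1ᶜ ⟩
          1ᶜ         ∎))
          where
          trivial : ∀ n → ζ (s j) (toℕ (origin j) ℕ.* n) ≈ᶜ 1ᶜ
          trivial n = ℂ.trans
            (ℂ.reflexive (≡.cong (λ i → ζ (s j) (i ℕ.* n)) (Fin.toℕ-fromℕ< (1≤s j)))) (ζ-0 (s j))

        indicator : G[_] s I → G s → ℂ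
        indicator β x = productᶜ λ j → sumᶜ λ i → summand β j (j ∈? I) i x

        sumOver-indicator′ : ∀ β A → sumOver A (λ x → 1ᶜ *ᶜ indicator β x) ≈ᶜ fromℝ (fromℕ (multiplicity s I β A))
        sumOver-indicator′ β A = ℂ.trans (sumOver-cong A (λ x → ℂ.*-identityˡ (indicator β x)))
          (sumOver-indicator s I β (indicator β)
            (λ x → product-indicator _ (Agree β x) (λ j → sum-summand β x j (j ∈? I))) A)

      -- Both multiplicities are sums of indicators over A. Their expansions run over the same
      -- choices of modes, so they can be compared one mode at a time, and natural numbers with
      -- equal images in ℂ are equal.
      multiplicity-constant : ∀ A →
        (∀ m → ¬ IsZero s m → ∣ supp s m ∣ ℕ.≤ ∣ I ∣ → sumOver A (χ exp π s m) ≈ᶜ 0ᶜ) →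
        ∀ β γ → multiplicity s I β A ≡ multiplicity s I γ A
      multiplicity-constant A sums≈0 β γ = fromℕ-injective (proj₁ (begin
        fromℝ (fromℕ (multiplicity s I β A))       ≈⟨ sumOver-indicator′ β A ⟨
        sumOver A (λ x → 1ᶜ *ᶜ indicator β x)
          ≈⟨ sumOver-multilinear A (λ j → modeCount j (j ∈? I)) (λ j → summand β j (j ∈? I))
               (λ j → summand γ j (j ∈? I)) (λ _ → 1ᶜ) (λ _ → 1ᶜ) modes-agree ⟩
        sumOver A (λ x → 1ᶜ *ᶜ indicator γ x)      ≈⟨ sumOver-indicator′ γ A ⟩
        fromℝ (fromℕ (multiplicity s I γ A))       ∎))
        where
        module _ (m : ∀ j → Fin (modeCount j (j ∈? I))) where
          M : G s
          M j = mode j (j ∈? I) (m j)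

          -- The part of a mode that does not depend on the row; the remaining part is `χ` at `M`.
          coefficient : G[_] s I → Fin k → ℂ
          coefficient β j = weight j (j ∈? I) *ᶜ
            ζ (s j) (toℕ (M j) ℕ.* (s j ℕ.∸ toℕ (extend β j (j ∈? I))))

          expand : ∀ β → sumOver A (λ x → 1ᶜ *ᶜ productᶜ (λ j → summand β j (j ∈? I) (m j) x)) ≈ᶜ
            productᶜ (coefficient β) *ᶜ sumOver A (χ exp π s M)
          expand β = ℂ.trans (sumOver-cong A λ x → begin
            1ᶜ *ᶜ productᶜ (λ j → summand β j (j ∈? I) (m j) x)
              ≈⟨ ℂ.*-identityˡ (productᶜ (λ j → summand β j (j ∈? I) (m j) x)) ⟩
            productᶜ (λ j → summand β j (j ∈? I) (m j) x)
              ≈⟨ Π.sum-cong-≋ {k} (λ j → regroup (weight j (j ∈? I)) (factor M x j) _) ⟩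
            productᶜ (λ j → coefficient β j *ᶜ factor M x j)
              ≈⟨ Π.∑-distrib-+ (coefficient β) (factor M x) ⟩
            productᶜ (coefficient β) *ᶜ χ exp π s M x ∎)
            (sumOver-*ˡ (productᶜ (coefficient β)) A (χ exp π s M))
            where
            regroup : ∀ w u v → w *ᶜ (u *ᶜ v) ≈ᶜ (w *ᶜ v) *ᶜ u
            regroup w u v = ℂ.trans (*ᶜ-congˡ w (ℂ.*-comm u v)) (ℂ.sym (ℂ.*-assoc w v u))

          supp⊆I : supp s M ⊆ I
          supp⊆I {j} j∈supp = decide (j ∈? I) (m j) (∈supp⇒≢0 M j∈supp)
            where
            decide : ∀ d i → toℕ (mode j d i) ≢ 0 → j ∈ I
            decide (yes j∈I) _ _ = j∈I
            decide (no  _)   _ ≢0 = contradiction (Fin.toℕ-fromℕ< (1≤s j)) ≢0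

          modes-agree :
            sumOver A (λ x → 1ᶜ *ᶜ productᶜ (λ j → summand β j (j ∈? I) (m j) x)) ≈ᶜ
            sumOver A (λ x → 1ᶜ *ᶜ productᶜ (λ j → summand γ j (j ∈? I) (m j) x))
          modes-agree = ℂ.trans (expand β)
            (ℂ.trans (decide (Fin.all? (λ j → toℕ (M j) ℕ.≟ 0))) (ℂ.sym (expand γ)))
            where
            S = sumOver A (χ exp π s M)
            decide : Dec (IsZero s M) → productᶜ (coefficient β) *ᶜ S ≈ᶜ productᶜ (coefficient γ) *ᶜ S
            -- At the trivial character the exponents that involve β and γ are multiplied by 0, and
            -- the weights do not see the point.
            decide (yes M≡0) = *ᶜ-congʳ S (Π.sum-cong-≋ {k} λ j → *ᶜ-congˡ (weight j (j ∈? I))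
              (ℂ.reflexive (≡.cong (ζ (s j)) (≡.trans (≡.cong (ℕ._* _) (M≡0 j)) (≡.sym (≡.cong (ℕ._* _) (M≡0 j)))))))
            decide (no  M≢0) = ℂ.trans (vanish β) (ℂ.sym (vanish γ))
              where
              vanish : ∀ β → productᶜ (coefficient β) *ᶜ S ≈ᶜ 0ᶜ
              vanish β = ℂ.trans (*ᶜ-congˡ (productᶜ (coefficient β)) (sums≈0 M M≢0 (p⊆q⇒∣p∣≤∣q∣ supp⊆I)))
                (ℂ.zeroʳ (productᶜ (coefficient β)))

    character-sum≈0⇒IsOA : ∀ {t A} → (∀ j → 1 ℕ.≤ s j) → A ≢ [] →
      (∀ m → ¬ IsZero s m → ∣ supp s m ∣ ℕ.≤ t → sumOver A (χ exp π s m) ≈ᶜ 0ᶜ) → IsOA s t A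
    character-sum≈0⇒IsOA {A = []}    1≤s A≢[] sums≈0 = contradiction ≡.refl A≢[]
    character-sum≈0⇒IsOA {A = α ∷ A} 1≤s A≢[] sums≈0 I ≡.refl =
      -- λ is read off at the projection of the first row; that row lies over its own projection,
      -- which makes λ positive.
      multiplicity s I (proj s I α) (α ∷ A) ,
      ≡.subst (0 ℕ.<_) (≡.sym (multiplicity-accept I A (λ _ _ → ≡.refl))) (s≤s z≤n) ,
      λ β → multiplicity-constant 1≤s I (α ∷ A) sums≈0 β (proj s I α)

lemma2p4 : ∀ {c ℓ₁ ℓ₂} (R : RealNumbers c ℓ₁ ℓ₂) →
  let open RealNumbers R using () renaming (Carrier to ℝ)
      open Complex R
      open Characters R
  in
  (exp : ℂ → ℂ) → IsExp exp →
  (π : ℝ) → IsPi exp π →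
  (k t : ℕ) → 1 ≤ t → t ≤ k →
  (s : Fin k → ℕ) → (∀ j → 1 ≤ s j) →
  (A : List (G s)) → A ≢ [] →
  IsOA s t A ⇔
    (∀ (m : G s) → ¬ IsZero s m → ∣ supp s m ∣ ≤ t →
      sumOver A (χ exp π s m) ≈ᶜ 0ᶜ)
lemma2p4 R exp isExp π isPi k t 1≤t t≤k s 1≤s A A≢[] = mk⇔
  (IsOA⇒character-sum≈0 s {t} {A} t≤k) (character-sum≈0⇒IsOA s {t} {A} 1≤s A≢[])
  where open CharacterTheory R exp isExp π isPi
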